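{- For all integers $n\ge1$ and $a,b\ge 0$ there exists a bijection $\psi:\overline{\mathcal D}_n^{(a,b)}\to\overline{\mathcal D}_n^{(b,a)}$ such that for every $D\in\overline{\mathcal D}_n^{(a,b)}$ we have $\mathsf{area}(D)=\mathsf{area}(\psi(D))$ and $\mathsf{bounce}'(D)=\mathsf{bounce}'(\psi(D))$.
   Context: A Dyck path of size $n$ is a lattice path from $(0,0)$ to $(n,n)$ with unit north and east steps staying weakly above $y=x$. Its $i$-th north step lies in row $i$ (between heights $i-1$ and $i$); the area word $w_1(D)\cdots w_n(D)$ records the number $w_i(D)$ of whole unit squares in row $i$ between the path and $y=x$. A peak is a north step followed by an east step; a rise is a north step followed by a north step. $\mathcal D_n^{(a,b)}$ is the set of Dyck paths of size $n$ with a choice of $a$ decorated peaks and $b$ decorated rises; $\mathsf{Peak}(D)$, $\mathsf{Rise}(D)$ are the sets of indices $i$ such that the $i$-th north step is a decorated peak, resp. rise. $\mathsf{area}(D)=\sum_i w_i(D)-\sum_{j\in\mathsf{Rise}(D)}w_{j+1}(D)$. Second bounce: let $p_i$ be the number of elements of $\mathsf{Peak}(D)$ smaller than $i$; delete every east step immediately following a decorated peak and translate later steps left to get a connected path $\bar D$ from $(0,0)$ to $(n-a,n)$; the modified diagonal is the union over $i$ of the segments from $(i-1-p_i,i-1)$ to $(i-p_i,i)$. The second bounce path starts at $(0,0)$, goes north until it reaches the starting point of an east step of $\bar D$, then east until it meets the modified diagonal, then north, etc., until $(n-a,n)$; its north steps are labelled $0$ before its first north-to-east turn, $1$ between the first and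 second turns, etc.; $\mathsf{bounce}'(D)$ is the sum of all these labels. $\overline{\mathcal D}_n^{(a,b)}\subseteq\mathcal D_n^{(a,b)}$ consists of the elements whose last peak (the peak in row $n$) is not decorated. -}

module Defs where

open import Data.Bool using (Bool; true; false; _∧_; _∨_; not; if_then_else_; T)
open import Data.Nat using (ℕ; zero; suc; _+_; _*_; _∸_; _≡ᵇ_; _<ᵇ_)
open import Data.Nat.ListAction using (sum)
open import Data.List using (List; []; _∷_; zipWith; drop; take; upTo)
open import Data.Vec using (Vec; toList)
open import Data.Product using (Σ; proj₁)

data Step : Set where
  N E : Step

countN : List Step → ℕ
countN []      = 0
countN (N ∷ s) = suc (countN s)
countN (E ∷ s) = countN s

countE : List Step → ℕ
countE []      = 0
countE (N ∷ s) = countE s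
countE (E ∷ s) = suc (countE s)

aboveDiag : ℕ → List Step → Bool
aboveDiag d       []      = true
aboveDiag d       (N ∷ s) = aboveDiag (suc d) s
aboveDiag zero    (E ∷ s) = false
aboveDiag (suc d) (E ∷ s) = aboveDiag d s

isDyck : ℕ → List Step → Bool
isDyck n p = aboveDiag 0 p ∧ ((countN p ≡ᵇ n) ∧ (countE p ≡ᵇ n))

peakFlags : List Step → List Bool
peakFlags []            = []
peakFlags (N ∷ E ∷ s)   = true ∷ peakFlags (E ∷ s)
peakFlags (N ∷ s)       = false ∷ peakFlags s
peakFlags (E ∷ s)       = peakFlags s

riseFlags : List Step → List Bool
riseFlags []            = []
riseFlags (N ∷ N ∷ s)   = true ∷ riseFlags (N ∷ s)
riseFlags (N ∷ s)       = false ∷ riseFlags s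
riseFlags (E ∷ s)       = riseFlags s

_⊆ᵇ_ : List Bool → List Bool → Bool
[]       ⊆ᵇ []       = true
(d ∷ ds) ⊆ᵇ (f ∷ fs) = (not d ∨ f) ∧ (ds ⊆ᵇ fs)
_        ⊆ᵇ _        = false

countTrue : List Bool → ℕ
countTrue []          = 0
countTrue (true ∷ l)  = suc (countTrue l)
countTrue (false ∷ l) = countTrue l

-- Validity of a decorated Dyck path in D_n^(a,b):
-- the (characteristic vectors of the) decorated peaks/rises, indexed by
-- rows 1..n (position i-1 of the vector = row i), are subsets of the
-- peaks/rises of the path, of cardinality a and b respectively.
isDecDyck : (n a b : ℕ) → List Step → Vec Bool n → Vec Bool n → Bool
isDecDyck n a b p pk rs =
  isDyck n p
  ∧ ((toList pk ⊆ᵇ peakFlags p)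
  ∧ ((toList rs ⊆ᵇ riseFlags p)
  ∧ ((countTrue (toList pk) ≡ᵇ a)
  ∧ (countTrue (toList rs) ≡ᵇ b))))

record DDP (n a b : ℕ) : Set where
  constructor ddp
  field
    path  : List Step
    peak  : Vec Bool n   -- peak i-1 = true  iff  i ∈ Peak(D)
    rise  : Vec Bool n   -- rise i-1 = true  iff  i ∈ Rise(D)
    valid : T (isDecDyck n a b path peak rise)

open DDP public

lastFalse : List Bool → Bool
lastFalse []           = true
lastFalse (x ∷ [])     = not x
lastFalse (x ∷ y ∷ xs) = lastFalse (y ∷ xs)

DBar : (n a b : ℕ) → Set
DBar n a b = Σ (DDP n a b) (λ D → T (lastFalse (toList (peak D))))

eastBefore : ℕ → List Step → List ℕ
eastBefore k []      = []
eastBefore k (N ∷ s) = k ∷ eastBefore k s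
eastBefore k (E ∷ s) = eastBefore (suc k) s

areaWord : List Step → List ℕ
areaWord p = zipWith _∸_ (upTo (countN p)) (eastBefore 0 p)

area : ∀ {n a b} → DDP n a b → ℕ
area D =
  sum (areaWord (path D))
  ∸ sum (zipWith (λ r w → if r then w else 0) (toList (rise D)) (drop 1 (areaWord (path D))))

-- \bar D: delete each east step immediately following a decorated peak.
-- First argument: peak decorations of the remaining north steps.
barPath : List Bool → List Step → List Step
barPath ds          []          = []
barPath (true ∷ ds) (N ∷ E ∷ s) = N ∷ barPath ds s
barPath (d ∷ ds)    (N ∷ s)     = N ∷ barPath ds s
barPath []          (N ∷ s)     = N ∷ barPath [] s
barPath ds          (E ∷ s)     = E ∷ barPath ds s

-- for each east step (in order), the number of north steps before it,
-- i.e. the height at which it starts; entry x corresponds to the east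
-- step starting at abscissa x.
eastHeights : ℕ → List Step → List ℕ
eastHeights k []      = []
eastHeights k (N ∷ s) = eastHeights (suc k) s
eastHeights k (E ∷ s) = k ∷ eastHeights k s

nth : List ℕ → ℕ → ℕ
nth []      _       = 0
nth (x ∷ l) zero    = x
nth (x ∷ l) (suc i) = nth l i

-- bounceLoop fuel n eh pk x y k : the bounce path is at (x , y), about to
-- go north with label k.  It goes north to height h = height of the east
-- step of \bar D starting at abscissa x (contributing k per north step),
-- then east to the modified diagonal at height h, i.e. to abscissa
-- h - p_{h+1}, where p_{h+1} = #(decorated peaks in rows ≤ h); it stops
-- when h = n.
bounceLoop : ℕ → ℕ → List ℕ → List Bool → ℕ → ℕ → ℕ → ℕ
bounceLoop zero       n eh pk x y k = 0
bounceLoop (suc fuel) n eh pk x y k =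
  k * (h ∸ y)
  + (if h <ᵇ n then bounceLoop fuel n eh pk (h ∸ countTrue (take h pk)) h (suc k) else 0)
  where
  h : ℕ
  h = nth eh x

-- bounce'(D): sum of the labels of the north steps of the second bounce
-- path.  Each round raises the height by ≥ 1, so fuel n+1 suffices.
bounce′ : ∀ {n a b} → DDP n a b → ℕ
bounce′ {n} D =
  bounceLoop (suc n) n
    (eastHeights 0 (barPath (toList (peak D)) (path D)))
    (toList (peak D)) 0 0 0

{-# OPTIONS --safe #-}

-- Reading a decorated path from left to right, remember the number e of columns
-- that the current level of the second bounce path has still to cross, and the
-- number m of rows of this level read so far without decorated peak.  Their sum
-- is the height over the diagonal, and the bounce path turns north exactly when
-- an east step occurs at e = 0.  Hence the generating function of the completions
-- of a prefix (x, y, q, t marking decorated peaks, decorated rises, area and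
-- bounce) obeys a linear recursion in e, m and the number of remaining rows.
-- Expand it in the functions [e choose i] q^(i m) [m choose j] with q-binomial
-- coefficients: induction on the number of rows shows that the coefficient of
-- index (i , j) is symmetric in x and y up to the factor
-- (q + y) (q² + y) ⋯ (q^(i + j) + y).  The coefficient of index (0 , 0) at the
-- origin is the generating function of all decorated paths whose last peak is not
-- decorated.  Thus the sets of paths with exchanged numbers of decorations and
-- the same area and bounce have equal cardinalities.
module Submission where

open import Defs
open import Data.Nat using (ℕ; _≤_)
open import Data.Product using (Σ-syntax; _×_; proj₁)
open import Function.Bundles using (_⤖_; Bijection)
open import Relation.Binary.PropositionalEquality using (_≡_)

open import Algebra.Bundles using (CommutativeSemiring)
open import Data.Bool using (Bool; true; false; T; if_then_else_; _∧_)
open import Data.Bool.Properties using (T-∧; T-irrelevant; T-≡)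
open import Data.Empty using (⊥-elim)
open import Data.Fin using (Fin; zero)
open import Data.Fin.Properties using (+↔⊎)
open import Data.Integer as ℤ using (ℤ; 0ℤ)
import Data.Integer.Properties as ℤ
open import Data.List using (List; []; _∷_; replicate; zipWith; drop; take; applyUpTo)
import Data.List.Properties as List
open import Data.Nat as ℕ using (zero; suc)
open import Data.Nat.ListAction using (sum)
import Data.Nat.Properties as ℕ
open import Data.Nat.Solver using (module +-*-Solver)
open import Data.Product using (Σ; _,_; proj₂)
open import Data.Sum using (_⊎_; inj₁; inj₂)
open import Data.Sum.Function.Propositional using (_⊎-↔_)
open import Data.Unit using (tt)
open import Data.Vec using (Vec; []; _∷_; toList)
import Data.Vec.Properties as Vec
open import Function.Bundles using (_↔_; Inverse; Equivalence; mk⤖; mk↔ₛ′)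
open import Function.Construct.Composition using (_↔-∘_)
open import Function.Construct.Symmetry using (↔-sym)
open import Function.Properties.Inverse using (↔-refl)
import Relation.Binary.PropositionalEquality as ≡
open import Relation.Nullary using (Dec; yes; no)
open import Relation.Nullary.Decidable using (map′; _×-dec_)

-- Arrays of coefficients and their q-binomial functions of e and m.

module Transform {c ℓ} (R : CommutativeSemiring c ℓ)
                 (p t : CommutativeSemiring.Carrier R) where

  open CommutativeSemiring R hiding (zero)
  open import Algebra.Solver.Ring.NaturalCoefficients.Default R
  open import Relation.Binary.Reasoning.Setoid setoid

  Array : Set c
  Array = ℕ → ℕ → Carrier

  infix 4 _≋_
  _≋_ : Array → Array → Set ℓ
  f ≋ g = ∀ i j → f i j ≈ g i j

  -- Here q = 1 + p: in terms of q − 1 every identity below is one of semirings.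
  q^∸1 : ℕ → Carrier
  q^∸1 zero    = 0#
  q^∸1 (suc k) = p + (1# + p) * q^∸1 k

  q^ : ℕ → Carrier
  q^ k = 1# + q^∸1 k

  -- An array f stands for the function ∑ f i j [e choose i] q^(i m) [m choose j]
  -- of e and m with q-binomial coefficients; transform evaluates it, shiftE and
  -- shiftM are the substitutions e ↦ e + 1 and m ↦ m + 1 (q-Pascal rule),
  -- heightMul is the multiplication by q^(e + m), and mulQ that of the factor
  -- ∑ f j [m choose j] by q^m.
  mulQ : (ℕ → Carrier) → ℕ → Carrier
  mulQ f zero    = f zero
  mulQ f (suc j) = q^ (suc j) * f (suc j) + q^ j * q^∸1 (suc j) * f j

  shiftE shiftM heightMul : Array → Array
  shiftE f i j = q^ i * f i j + mulQ (f (suc i)) j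
  shiftM f i j = q^ i * (f i (suc j) + q^ j * f i j)
  heightMul f zero    j = mulQ (f zero) j
  heightMul f (suc i) j = q^ (suc i) * mulQ (f (suc i)) j + q^ i * q^∸1 (suc i) * f i j

  transform : Array → ℕ → ℕ → Carrier
  transform f zero    zero    = f zero zero
  transform f zero    (suc m) = transform (shiftM f) zero m
  transform f (suc e) m       = transform (shiftE f) e m

  -- If d stands for q^ k − 1, then q d stands for q^ k and up p d for q^ (k + 1) − 1.
  up : ∀ {n} → Polynomial n → Polynomial n → Polynomial n
  up p d = p :+ (con 1 :+ p) :* d

  q : ∀ {n} → Polynomial n → Polynomial n
  q d = con 1 :+ d

  q^-suc : ∀ k → q^ (suc k) ≈ (1# + p) * q^ k
  q^-suc k = solve 2 (λ p d → q (up p d) := q p :* q d) refl p (q^∸1 k)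

  mulQ-cong : ∀ {f g} → (∀ j → f j ≈ g j) → ∀ j → mulQ f j ≈ mulQ g j
  mulQ-cong f≈g zero    = f≈g zero
  mulQ-cong f≈g (suc j) = +-cong (*-congˡ (f≈g (suc j))) (*-congˡ (f≈g j))

  mulQ-lin : ∀ k l f g j → mulQ (λ j → k * f j + l * g j) j ≈ k * mulQ f j + l * mulQ g j
  mulQ-lin k l f g zero    = refl
  mulQ-lin k l f g (suc j) =
    solve 8 (λ k l a b f f′ g g′ → a :* (k :* f′ :+ l :* g′) :+ b :* (k :* f :+ l :* g)
                                := k :* (a :* f′ :+ b :* f) :+ l :* (a :* g′ :+ b :* g))
      refl k l (q^ (suc j)) (q^ j * q^∸1 (suc j)) (f j) (f (suc j)) (g j) (g (suc j))

  shiftE-cong : ∀ {f g} → f ≋ g → shiftE f ≋ shiftE g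
  shiftE-cong f≈g i j = +-cong (*-congˡ (f≈g i j)) (mulQ-cong (f≈g (suc i)) j)

  shiftM-cong : ∀ {f g} → f ≋ g → shiftM f ≋ shiftM g
  shiftM-cong f≈g i j = *-congˡ (+-cong (f≈g i (suc j)) (*-congˡ (f≈g i j)))

  transform-cong : ∀ {f g} → f ≋ g → ∀ e m → transform f e m ≈ transform g e m
  transform-cong f≈g zero    zero    = f≈g zero zero
  transform-cong f≈g zero    (suc m) = transform-cong (shiftM-cong f≈g) zero m
  transform-cong f≈g (suc e) m       = transform-cong (shiftE-cong f≈g) e m

  lin : Carrier → Carrier → Array → Array → Array
  lin k l f g i j = k * f i j + l * g i j

  shiftE-lin : ∀ k l f g → shiftE (lin k l f g) ≋ lin k l (shiftE f) (shiftE g)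
  shiftE-lin k l f g i j = trans (+-congˡ (mulQ-lin k l (f (suc i)) (g (suc i)) j))
    (solve 7 (λ k l a f g u v → a :* (k :* f :+ l :* g) :+ (k :* u :+ l :* v) := k :* (a :* f :+ u) :+ l :* (a :* g :+ v))
      refl k l (q^ i) (f i j) (g i j) (mulQ (f (suc i)) j) (mulQ (g (suc i)) j))

  shiftM-lin : ∀ k l f g → shiftM (lin k l f g) ≋ lin k l (shiftM f) (shiftM g)
  shiftM-lin k l f g i j =
    solve 8 (λ k l a b f f′ g g′ → a :* ((k :* f′ :+ l :* g′) :+ b :* (k :* f :+ l :* g))
                                := k :* (a :* (f′ :+ b :* f)) :+ l :* (a :* (g′ :+ b :* g)))
      refl k l (q^ i) (q^ j) (f i j) (f i (suc j)) (g i j) (g i (suc j))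

  transform-lin : ∀ k l f g e m →
    transform (lin k l f g) e m ≈ k * transform f e m + l * transform g e m
  transform-lin k l f g zero zero = refl
  transform-lin k l f g zero (suc m) =
    trans (transform-cong (shiftM-lin k l f g) zero m) (transform-lin k l (shiftM f) (shiftM g) zero m)
  transform-lin k l f g (suc e) m =
    trans (transform-cong (shiftE-lin k l f g) e m) (transform-lin k l (shiftE f) (shiftE g) e m)

  +0*-elim : ∀ a b → a + 0# * b ≈ a
  +0*-elim a b = trans (+-congˡ (zeroˡ b)) (+-identityʳ a)

  -- Scaling is a linear combination whose second factor is 0, so no induction beyond that of
  -- `transform-lin` is needed.
  transform-scale : ∀ k f e m → transform (λ i j → k * f i j) e m ≈ k * transform f e m
  transform-scale k f e m =
    trans (transform-cong (λ i j → sym (+0*-elim (k * f i j) (f i j))) e m)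
      (trans (transform-lin k 0# f f e m) (+0*-elim _ _))

  -- `transform` uses up e before it touches m. Since the two substitutions commute, a shift in m
  -- can also be made first, for any e: this is `transform-shiftM`.
  shiftE-shiftM : ∀ f → shiftE (shiftM f) ≋ shiftM (shiftE f)
  shiftE-shiftM f i zero =
    solve 6 (λ p a u v x y →
        q a :* (q a :* (v :+ q (con 0) :* u)) :+ q (up p a) :* (y :+ q (con 0) :* x)
        := q a :* ((q a :* v :+ (q (up p (con 0)) :* y :+ q (con 0) :* up p (con 0) :* x)) :+ q (con 0) :* (q a :* u :+ x)))
      refl p (q^∸1 i) (f i 0) (f i 1) (f (suc i) 0) (f (suc i) 1)
  shiftE-shiftM f i (suc j) =
    solve 8 (λ p a b u v x y z →
        q a :* (q a :* (v :+ q (up p b) :* u))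
        :+ (q (up p b) :* (q (up p a) :* (z :+ q (up p b) :* y)) :+ q b :* up p b :* (q (up p a) :* (y :+ q b :* x)))
        := q a :* ((q a :* v :+ (q (up p (up p b)) :* z :+ q (up p b) :* up p (up p b) :* y))
                   :+ q (up p b) :* (q a :* u :+ (q (up p b) :* y :+ q b :* up p b :* x))))
      refl p (q^∸1 i) (q^∸1 j) (f i (suc j)) (f i (suc (suc j))) (f (suc i) j) (f (suc i) (suc j)) (f (suc i) (suc (suc j)))

  transform-shiftM : ∀ f e m → transform f e (suc m) ≈ transform (shiftM f) e m
  transform-shiftM f zero    m = refl
  transform-shiftM f (suc e) m =
    trans (transform-shiftM (shiftE f) e m) (transform-cong (λ i j → sym (shiftE-shiftM f i j)) e m)

  mulQ-scale : ∀ k f j → mulQ (λ j → k * f j) j ≈ k * mulQ f j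
  mulQ-scale k f j =
    trans (mulQ-cong (λ j → sym (+0*-elim (k * f j) (f j))) j)
      (trans (mulQ-lin k 0# f f j) (+0*-elim _ _))

  -- With F(m) the function of f, both sides expand q^(m + 1) F(m + 1): once by shifting q^m F(m),
  -- once as q times q^m F(m + 1).
  mulQ-shift : ∀ f j → mulQ f (suc j) + q^ j * mulQ f j ≈ (1# + p) * mulQ (λ j → f (suc j) + q^ j * f j) j
  mulQ-shift f zero =
    solve 3 (λ p f f′ →
        (q (up p (con 0)) :* f′ :+ q (con 0) :* up p (con 0) :* f) :+ q (con 0) :* f
        := q p :* (f′ :+ q (con 0) :* f))
      refl p (f 0) (f 1)
  mulQ-shift f (suc j) =
    solve 5 (λ p b f f′ f″ →
        (q (up p (up p b)) :* f″ :+ q (up p b) :* up p (up p b) :* f′) :+ q (up p b) :* (q (up p b) :* f′ :+ q b :* up p b :* f)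
        := q p :* (q (up p b) :* (f″ :+ q (up p b) :* f′) :+ q b :* up p b :* (f′ :+ q b :* f)))
      refl p (q^∸1 j) (f j) (f (suc j)) (f (suc (suc j)))

  -- Raising e by one turns q^(e + m) into q q^(e + m). Linearity of `mulQ` splits the nested sums,
  -- and what remains is a polynomial identity in p and `q^∸1 i`.
  shiftE-heightMul : ∀ f → shiftE (heightMul f) ≋ λ i j → (1# + p) * heightMul (shiftE f) i j
  shiftE-heightMul f zero j = begin
    q^ 0 * mulQ (f 0) j + mulQ (heightMul f 1) j
      ≈⟨ +-congˡ (mulQ-lin (q^ 1) (q^ 0 * q^∸1 1) (mulQ (f 1)) (f 0) j) ⟩
    q^ 0 * mulQ (f 0) j + (q^ 1 * mulQ (mulQ (f 1)) j + q^ 0 * q^∸1 1 * mulQ (f 0) j)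
      ≈⟨ solve 3 (λ p u v →
           q (con 0) :* u :+ (q (up p (con 0)) :* v :+ q (con 0) :* up p (con 0) :* u) := q p :* (q (con 0) :* u :+ con 1 :* v))
         refl p (mulQ (f 0) j) (mulQ (mulQ (f 1)) j) ⟩
    (1# + p) * (q^ 0 * mulQ (f 0) j + 1# * mulQ (mulQ (f 1)) j)
      ≈⟨ *-congˡ (mulQ-lin (q^ 0) 1# (f 0) (mulQ (f 1)) j) ⟨
    (1# + p) * mulQ (λ j → q^ 0 * f 0 j + 1# * mulQ (f 1) j) j
      ≈⟨ *-congˡ (mulQ-cong (λ j → +-congˡ (*-identityˡ _)) j) ⟩
    (1# + p) * mulQ (shiftE f 0) j ∎
  shiftE-heightMul f (suc i) j = begin
    q^ (suc i) * heightMul f (suc i) j + mulQ (heightMul f (suc (suc i))) j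
      ≈⟨ +-congˡ (mulQ-lin (q^ (suc (suc i))) (q^ (suc i) * q^∸1 (suc (suc i))) (mulQ (f (suc (suc i)))) (f (suc i)) j) ⟩
    q^ (suc i) * heightMul f (suc i) j
      + (q^ (suc (suc i)) * mulQ (mulQ (f (suc (suc i)))) j + q^ (suc i) * q^∸1 (suc (suc i)) * mulQ (f (suc i)) j)
      ≈⟨ solve 5 (λ p a f u v →
           q (up p a) :* (q (up p a) :* u :+ q a :* up p a :* f) :+ (q (up p (up p a)) :* v :+ q (up p a) :* up p (up p a) :* u)
           := q p :* (q (up p a) :* (q (up p a) :* u :+ con 1 :* v) :+ q a :* up p a :* (q a :* f :+ u)))
         refl p (q^∸1 i) (f i j) (mulQ (f (suc i)) j) (mulQ (mulQ (f (suc (suc i)))) j) ⟩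
    (1# + p) * (q^ (suc i) * (q^ (suc i) * mulQ (f (suc i)) j + 1# * mulQ (mulQ (f (suc (suc i)))) j)
                + q^ i * q^∸1 (suc i) * shiftE f i j)
      ≈⟨ *-congˡ (+-congʳ (*-congˡ (mulQ-lin (q^ (suc i)) 1# (f (suc i)) (mulQ (f (suc (suc i)))) j))) ⟨
    (1# + p) * (q^ (suc i) * mulQ (λ j → q^ (suc i) * f (suc i) j + 1# * mulQ (f (suc (suc i))) j) j
                + q^ i * q^∸1 (suc i) * shiftE f i j)
      ≈⟨ *-congˡ (+-congʳ (*-congˡ (mulQ-cong (λ j → +-congˡ (*-identityˡ _)) j))) ⟩
    (1# + p) * heightMul (shiftE f) (suc i) j ∎

  shiftM-heightMul : ∀ f → shiftM (heightMul f) ≋ λ i j → (1# + p) * heightMul (shiftM f) i j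
  shiftM-heightMul f zero j = begin
    q^ 0 * (mulQ (f 0) (suc j) + q^ j * mulQ (f 0) j)
      ≈⟨ *-congˡ (mulQ-shift (f 0) j) ⟩
    q^ 0 * ((1# + p) * mulQ (λ j → f 0 (suc j) + q^ j * f 0 j) j)
      ≈⟨ solve 3 (λ a b c → a :* (b :* c) := b :* (a :* c)) refl (q^ 0) (1# + p) _ ⟩
    (1# + p) * (q^ 0 * mulQ (λ j → f 0 (suc j) + q^ j * f 0 j) j)
      ≈⟨ *-congˡ (mulQ-scale (q^ 0) (λ j → f 0 (suc j) + q^ j * f 0 j) j) ⟨
    (1# + p) * mulQ (shiftM f 0) j ∎
  shiftM-heightMul f (suc i) j = begin
    q^ (suc i) * ((q^ (suc i) * mulQ g (suc j) + q^ i * q^∸1 (suc i) * f i (suc j))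
                  + q^ j * (q^ (suc i) * mulQ g j + q^ i * q^∸1 (suc i) * f i j))
      ≈⟨ solve 7 (λ p a b u u′ f f′ →
           q (up p a) :* ((q (up p a) :* u′ :+ q a :* up p a :* f′) :+ q b :* (q (up p a) :* u :+ q a :* up p a :* f))
           := q (up p a) :* (q (up p a) :* (u′ :+ q b :* u)) :+ q p :* (q a :* up p a :* (q a :* (f′ :+ q b :* f))))
         refl p (q^∸1 i) (q^∸1 j) (mulQ g j) (mulQ g (suc j)) (f i j) (f i (suc j)) ⟩
    q^ (suc i) * (q^ (suc i) * (mulQ g (suc j) + q^ j * mulQ g j)) + (1# + p) * rest
      ≈⟨ +-congʳ (*-congˡ (*-congˡ (mulQ-shift g j))) ⟩
    q^ (suc i) * (q^ (suc i) * ((1# + p) * mulQ (λ j → g (suc j) + q^ j * g j) j)) + (1# + p) * rest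
      ≈⟨ solve 4 (λ a b u r → a :* (a :* (b :* u)) :+ b :* r := b :* (a :* (a :* u) :+ r)) refl (q^ (suc i)) (1# + p) _ rest ⟩
    (1# + p) * (q^ (suc i) * (q^ (suc i) * mulQ (λ j → g (suc j) + q^ j * g j) j) + rest)
      ≈⟨ *-congˡ (+-congʳ (*-congˡ (mulQ-scale (q^ (suc i)) (λ j → g (suc j) + q^ j * g j) j))) ⟨
    (1# + p) * heightMul (shiftM f) (suc i) j ∎
    where
    g    = f (suc i)
    rest = q^ i * q^∸1 (suc i) * shiftM f i j

  transform-heightMul : ∀ f e m → transform (heightMul f) e m ≈ q^ (e ℕ.+ m) * transform f e m
  transform-heightMul f zero zero = sym (solve 1 (λ a → (con 1 :+ con 0) :* a := a) refl (f 0 0))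
  transform-heightMul f zero (suc m) = begin
    transform (shiftM (heightMul f)) 0 m                      ≈⟨ transform-cong (shiftM-heightMul f) 0 m ⟩
    transform (λ i j → (1# + p) * heightMul (shiftM f) i j) 0 m ≈⟨ transform-scale (1# + p) (heightMul (shiftM f)) 0 m ⟩
    (1# + p) * transform (heightMul (shiftM f)) 0 m           ≈⟨ *-congˡ (transform-heightMul (shiftM f) 0 m) ⟩
    (1# + p) * (q^ m * transform f 0 (suc m))                 ≈⟨ *-assoc _ _ _ ⟨
    (1# + p) * q^ m * transform f 0 (suc m)                   ≈⟨ *-congʳ (q^-suc m) ⟨
    q^ (suc m) * transform f 0 (suc m) ∎
  transform-heightMul f (suc e) m = begin
    transform (shiftE (heightMul f)) e m                      ≈⟨ transform-cong (shiftE-heightMul f) e m ⟩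
    transform (λ i j → (1# + p) * heightMul (shiftE f) i j) e m ≈⟨ transform-scale (1# + p) (heightMul (shiftE f)) e m ⟩
    (1# + p) * transform (heightMul (shiftE f)) e m           ≈⟨ *-congˡ (transform-heightMul (shiftE f) e m) ⟩
    (1# + p) * (q^ (e ℕ.+ m) * transform f (suc e) m)         ≈⟨ *-assoc _ _ _ ⟨
    (1# + p) * q^ (e ℕ.+ m) * transform f (suc e) m           ≈⟨ *-congʳ (q^-suc (e ℕ.+ m)) ⟨
    q^ (suc e ℕ.+ m) * transform f (suc e) m ∎

  -- North steps, east steps and turns as operations on arrays.

  t^ : ℕ → Carrier
  t^ zero    = 1#
  t^ (suc r) = t * t^ r

  -- If f describes, up to the factor q^(e + m), the completions that continue with
  -- a north step, then full describes all completions, and tail those that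
  -- continue with an east step; T accounts for the rows above a turn of the bounce
  -- path.
  module Round (T : Carrier) (f : Array) where

    tail full : Array
    tail zero    zero    = 0#
    tail zero    (suc j) = T * (q^ j * f j zero)
    tail (suc i) j       = q^ i * f i j
    full i j = heightMul f i j + tail i j

    -- An east step from e + 1 leads to an arbitrary completion at e. The rows i ≥ 1 of `tail` are
    -- chosen to make this true.
    shiftE-tail : shiftE tail ≋ full
    shiftE-tail zero j = begin
      q^ 0 * tail 0 j + mulQ (λ j → q^ 0 * f 0 j) j ≈⟨ +-congˡ (mulQ-scale (q^ 0) (f 0) j) ⟩
      q^ 0 * tail 0 j + q^ 0 * mulQ (f 0) j
        ≈⟨ solve 2 (λ u v → (con 1 :+ con 0) :* u :+ (con 1 :+ con 0) :* v := v :+ u) refl (tail 0 j) (mulQ (f 0) j) ⟩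
      mulQ (f 0) j + tail 0 j ∎
    shiftE-tail (suc i) j = begin
      q^ (suc i) * (q^ i * f i j) + mulQ (λ j → q^ (suc i) * f (suc i) j) j ≈⟨ +-congˡ (mulQ-scale (q^ (suc i)) (f (suc i)) j) ⟩
      q^ (suc i) * (q^ i * f i j) + q^ (suc i) * mulQ (f (suc i)) j
        ≈⟨ solve 4 (λ p a f u →
             q (up p a) :* (q a :* f) :+ q (up p a) :* u := (q (up p a) :* u :+ q a :* up p a :* f) :+ q a :* f)
           refl p (q^∸1 i) (f i j) (mulQ (f (suc i)) j) ⟩
      full (suc i) j ∎

    transform-full : ∀ e m → transform full e m ≈ q^ (e ℕ.+ m) * transform f e m + transform tail e m
    transform-full e m = begin
      transform full e m
        ≈⟨ transform-cong (λ i j → +-cong (*-identityˡ _) (*-identityˡ _)) e m ⟨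
      transform (lin 1# 1# (heightMul f) tail) e m
        ≈⟨ transform-lin 1# 1# (heightMul f) tail e m ⟩
      1# * transform (heightMul f) e m + 1# * transform tail e m
        ≈⟨ +-cong (*-identityˡ _) (*-identityˡ _) ⟩
      transform (heightMul f) e m + transform tail e m
        ≈⟨ +-congʳ (transform-heightMul f e m) ⟩
      q^ (e ℕ.+ m) * transform f e m + transform tail e m ∎

    full-east : ∀ e m → transform full (suc e) m ≈ q^ (suc e ℕ.+ m) * transform f (suc e) m + transform full e m
    full-east e m = trans (transform-full (suc e) m) (+-congˡ (transform-cong shiftE-tail e m))

    -- This recursion for a turn determines row 0 of `tail`, starting from 0 because no east step
    -- leaves the diagonal. The two terms of `full (suc j) 0` that contain `f j 0` add up to q^j
    -- q^(j + 1) `f j 0`, which gives the solution T q^j `f j 0`.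
    shiftM-tail : ∀ j → shiftM tail 0 j ≈ T * full j 0
    shiftM-tail zero =
      solve 2 (λ T f → (con 1 :+ con 0) :* (T :* ((con 1 :+ con 0) :* f) :+ (con 1 :+ con 0) :* con 0) := T :* (f :+ con 0)) refl T (f 0 0)
    shiftM-tail (suc j) =
      solve 5 (λ p T b f f′ →
           q (con 0) :* (T :* (q (up p b) :* f′) :+ q (up p b) :* (T :* (q b :* f)))
           := T :* ((q (up p b) :* f′ :+ q b :* up p b :* f) :+ q b :* f))
        refl p T (q^∸1 j) (f j 0) (f (suc j) 0)

  -- For e = 0, and likewise for m = 0, only one q-binomial coefficient survives, and it is the same
  -- function on both axes. A turn exchanges the two axes: the rows without decorated peak become
  -- the columns to cross.
  transform-transpose : ∀ {f g} → (∀ j → g 0 j ≈ f j 0) → ∀ m → transform g 0 m ≈ transform f m 0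
  transform-transpose h zero = h 0
  transform-transpose {f} {g} h (suc m) = transform-transpose step m
    where
    step : ∀ j → shiftM g 0 j ≈ shiftE f j 0
    step j = trans (*-congˡ (+-cong (h (suc j)) (*-congˡ (h j))))
      (solve 3 (λ b u v → (con 1 :+ con 0) :* (v :+ b :* u) := b :* u :+ v) refl (q^ j) (f j 0) (f (suc j) 0))

  full-turn : ∀ T f m → let open Round T f in
    transform full 0 (suc m) ≈ q^ (suc m) * transform f 0 (suc m) + T * transform full m 0
  full-turn T f m = trans (transform-full 0 (suc m)) (+-congˡ
    (trans (transform-transpose shiftM-tail m) (transform-scale T full m 0)))
    where open Round T f

  full-origin : ∀ T f → Round.full T f 0 0 ≈ f 0 0
  full-origin T f = +-identityʳ (f 0 0)

  module Coefficients (x y : Carrier) where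

    -- The summands are the three kinds of north step. A decorated peak leaves e and m unchanged,
    -- the other two raise m. After a decorated rise a north step is forced and the cells of its row
    -- do not count, hence f there without the factor q^(e + m + 1).
    next : Carrier → Array → Array
    next T f i j = x * full i j + (shiftM full i j + y * shiftM f i j)
      where open Round T f

    transform-next : ∀ T f e m → let open Round T f in
      transform (next T f) e m ≈ x * transform full e m + (transform full e (suc m) + y * transform f e (suc m))
    transform-next T f e m = begin
      transform (next T f) e m
        ≈⟨ transform-cong (λ i j → +-congˡ (trans (*-identityˡ _) (+-congʳ (*-identityˡ _)))) e m ⟨
      transform (lin x 1# full (lin 1# y (shiftM full) (shiftM f))) e m
        ≈⟨ transform-lin x 1# full (lin 1# y (shiftM full) (shiftM f)) e m ⟩
      x * transform full e m + 1# * transform (lin 1# y (shiftM full) (shiftM f)) e m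
        ≈⟨ +-congˡ (trans (*-identityˡ _) (transform-lin 1# y (shiftM full) (shiftM f) e m)) ⟩
      x * transform full e m + (1# * transform (shiftM full) e m + y * transform (shiftM f) e m)
        ≈⟨ +-congˡ (+-cong (*-identityˡ _) refl) ⟩
      x * transform full e m + (transform (shiftM full) e m + y * transform (shiftM f) e m)
        ≈⟨ +-congˡ (+-cong (transform-shiftM full e m) (*-congˡ (transform-shiftM f e m))) ⟨
      x * transform full e m + (transform full e (suc m) + y * transform f e (suc m)) ∎
      where open Round T f

    coeff : ℕ → Array
    coeff zero    zero    zero    = 1#
    coeff zero    zero    (suc _) = 0#
    coeff zero    (suc _) _       = 0#
    coeff (suc r) = next (t^ (suc r)) (coeff r)

    -- `coeff 0` expands the constant function 1, which both shifts preserve. Stating this for every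
    -- f equal to `coeff 0` lets the induction pass to the shifted arrays.
    transform-coeff0 : ∀ {f} → f ≋ coeff 0 → ∀ e m → transform f e m ≈ 1#
    transform-coeff0 h zero zero = h 0 0
    transform-coeff0 {f} h zero (suc m) = transform-coeff0 step zero m
      where
      step : shiftM f ≋ coeff 0
      step i j = trans (shiftM-cong h i j) (lemma i j)
        where
        lemma : shiftM (coeff 0) ≋ coeff 0
        lemma zero    zero    = solve 0 ((con 1 :+ con 0) :* (con 0 :+ (con 1 :+ con 0) :* con 1) := con 1) refl
        lemma zero    (suc j) = solve 1 (λ b → (con 1 :+ con 0) :* (con 0 :+ b :* con 0) := con 0) refl (q^ (suc j))
        lemma (suc i) j       = solve 2 (λ a b → a :* (con 0 :+ b :* con 0) := con 0) refl (q^ (suc i)) (q^ j)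
    transform-coeff0 {f} h (suc e) m = transform-coeff0 step e m
      where
      mulQ-0 : ∀ j → mulQ (λ _ → 0#) j ≈ 0#
      mulQ-0 zero    = refl
      mulQ-0 (suc j) = solve 2 (λ a b → a :* con 0 :+ b :* con 0 := con 0) refl (q^ (suc j)) (q^ j * q^∸1 (suc j))
      lemma : shiftE (coeff 0) ≋ coeff 0
      lemma zero    j = trans (+-congˡ (mulQ-0 j)) (solve 1 (λ u → (con 1 :+ con 0) :* u :+ con 0 := u) refl (coeff 0 0 j))
      lemma (suc i) j = trans (+-congˡ (mulQ-0 j)) (solve 1 (λ a → a :* con 0 :+ con 0 := con 0) refl (q^ (suc i)))
      step : shiftE f ≋ coeff 0
      step i j = trans (shiftE-cong h i j) (lemma i j)

  -- Symmetry of the coefficients in x and y.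

  q^-+ : ∀ i j → q^ (i ℕ.+ j) ≈ q^ i * q^ j
  q^-+ zero    j = solve 1 (λ a → a := (con 1 :+ con 0) :* a) refl (q^ j)
  q^-+ (suc i) j = trans (q^-suc (i ℕ.+ j)) (trans (*-congˡ (q^-+ i j))
    (trans (sym (*-assoc _ _ _)) (*-congʳ (sym (q^-suc i)))))

  -- The coefficient of index (i , j) becomes symmetric in x and y after
  -- multiplication by (q + y) (q² + y) ⋯ (q^(i + j) + y).
  weight : Carrier → ℕ → Carrier
  weight y zero    = 1#
  weight y (suc n) = (q^ (suc n) + y) * weight y n

  module Twist (x y : Carrier) where

    -- In use, u is computed from (x , y) and u′ in the same way from (y , x). Cross-multiplication
    -- replaces division by the weights.
    record Twisted (n : ℕ) (u u′ : Carrier) : Set ℓ where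
      constructor twisted
      field balance : weight y n * u ≈ weight x n * u′
    open Twisted

    infixl 6 _⟨+⟩_
    _⟨+⟩_ : ∀ {n u u′ v v′} → Twisted n u u′ → Twisted n v v′ → Twisted n (u + v) (u′ + v′)
    twisted h ⟨+⟩ twisted k = twisted (trans (distribˡ _ _ _) (trans (+-cong h k) (sym (distribˡ _ _ _))))

    scale : ∀ {n u u′} k → Twisted n u u′ → Twisted n (k * u) (k * u′)
    scale {n} {u} {u′} k h = twisted (begin
      weight y n * (k * u)  ≈⟨ swap _ _ _ ⟩
      k * (weight y n * u)  ≈⟨ *-congˡ (balance h) ⟩
      k * (weight x n * u′) ≈⟨ swap _ _ _ ⟨
      weight x n * (k * u′) ∎)
      where
      swap : ∀ a b c → a * (b * c) ≈ b * (a * c)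
      swap = solve 3 (λ a b c → a :* (b :* c) := b :* (a :* c)) refl

    resp : ∀ {n u u′ v v′} → u ≈ v → u′ ≈ v′ → Twisted n v v′ → Twisted n u u′
    resp e e′ (twisted h) = twisted (trans (*-congˡ e) (trans h (*-congˡ (sym e′))))

    -- Q + y and Q + x are the top factors of the weights of index n + 1, so they can be moved from
    -- the weights to u and u′. A separate Q admits products such as q^i q^j.
    lower : ∀ {n u u′ Q} → Q ≈ q^ (suc n) → Twisted (suc n) u u′ → Twisted n ((Q + y) * u) ((Q + x) * u′)
    lower {n} {u} {u′} {Q} e h = twisted (begin
      weight y n * ((Q + y) * u)            ≈⟨ *-congˡ (*-congʳ (+-congʳ e)) ⟩
      weight y n * ((q^ (suc n) + y) * u)   ≈⟨ swap _ _ _ ⟩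
      weight y (suc n) * u                  ≈⟨ balance h ⟩
      weight x (suc n) * u′                 ≈⟨ swap _ _ _ ⟨
      weight x n * ((q^ (suc n) + x) * u′)  ≈⟨ *-congˡ (*-congʳ (+-congʳ e)) ⟨
      weight x n * ((Q + x) * u′) ∎)
      where
      swap : ∀ a b c → a * (b * c) ≈ b * a * c
      swap = solve 3 (λ a b c → a :* (b :* c) := b :* a :* c) refl

    -- The new top factor of each weight equals the factor put on the other side, so both sides gain
    -- the same product (Q + x)(Q + y).
    raise : ∀ {n u u′ Q} → Q ≈ q^ (suc n) → Twisted n u u′ → Twisted (suc n) ((x + Q) * u) ((y + Q) * u′)
    raise {n} {u} {u′} {Q} e h = twisted (begin
      weight y (suc n) * ((x + Q) * u)          ≈⟨ *-congˡ (*-congʳ (+-congˡ e)) ⟩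
      weight y (suc n) * ((x + q^ (suc n)) * u) ≈⟨ rearrange y x _ _ _ ⟩
      (q^ (suc n) + y) * (x + q^ (suc n)) * (weight y n * u)  ≈⟨ *-congˡ (balance h) ⟩
      (q^ (suc n) + y) * (x + q^ (suc n)) * (weight x n * u′)
        ≈⟨ *-congʳ (solve 3 (λ a x y → (a :+ y) :* (x :+ a) := (a :+ x) :* (y :+ a)) refl (q^ (suc n)) x y) ⟩
      (q^ (suc n) + x) * (y + q^ (suc n)) * (weight x n * u′) ≈⟨ rearrange x y _ _ _ ⟨
      weight x (suc n) * ((y + q^ (suc n)) * u′) ≈⟨ *-congˡ (*-congʳ (+-congˡ e)) ⟨
      weight x (suc n) * ((y + Q) * u′) ∎)
      where
      rearrange : ∀ y x a w u → (a + y) * w * ((x + a) * u) ≈ (a + y) * (x + a) * (w * u)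
      rearrange = solve 5 (λ y x a w u → (a :+ y) :* w :* ((x :+ a) :* u) := (a :+ y) :* (x :+ a) :* (w :* u)) refl

    cast : ∀ {m n u u′} → m ≡ n → Twisted m u u′ → Twisted n u u′
    cast ≡.refl h = h

    module _ (T : Carrier) {f f′ : Array} (IH : ∀ i j → Twisted (i ℕ.+ j) (f i j) (f′ i j)) where
      open Coefficients

      -- Let n be the sum of the two indices. Up to factors free of x and y, entries of f of index
      -- sum n + 1 occur with q^(n + 1) + y and are lowered, those of index sum n - 1 occur with x +
      -- q^n and are raised. Those of index sum n have factors symmetric in x and y.
      next-twisted : ∀ i j → Twisted (i ℕ.+ j) (next x y T f i j) (next y x T f′ i j)
      next-twisted zero zero = resp (expand x y f) (trans (expand y x f′) (+-congˡ (*-congʳ (+-congʳ (+-comm y x)))))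
        (lower refl (IH 0 1) ⟨+⟩ scale _ (IH 0 0))
        where
        expand : ∀ x y f → next x y T f 0 0 ≈ (q^ 1 + y) * f 0 1 + (x + y + (q^ 1 + T)) * f 0 0
        expand x y f = solve 6 (λ p T x y u v → let o = con 0 in
          x :* (u :+ o) :+ (q o :* (((q (up p o) :* v :+ q o :* up p o :* u) :+ T :* (q o :* u)) :+ q o :* (u :+ o)) :+ y :* (q o :* (v :+ q o :* u)))
          := (q (up p o) :+ y) :* v :+ (x :+ y :+ (q (up p o) :+ T)) :* u) refl p T x y (f 0 0) (f 0 1)
      next-twisted zero (suc j) = resp (expand x y f) (trans (expand y x f′) (+-congʳ (+-congʳ (+-congʳ (+-congˡ (*-congʳ (+-congʳ (*-congˡ (+-comm y x)))))))))
        (lower refl (IH 0 (suc (suc j))) ⟨+⟩ scale _ (IH 0 (suc j)) ⟨+⟩ scale _ (raise refl (IH 0 j))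
          ⟨+⟩ scale _ (cast (ℕ.+-identityʳ (suc j)) (IH (suc j) 0)) ⟨+⟩ scale _ (raise refl (cast (ℕ.+-identityʳ j) (IH j 0))))
        where
        expand : ∀ x y f → next x y T f 0 (suc j) ≈
          (q^ (suc (suc j)) + y) * f 0 (suc (suc j))
          + (q^ (suc j) * (x + y) + (q^ (suc j) * q^∸1 (suc (suc j)) + q^ (suc j) * q^ (suc j))) * f 0 (suc j)
          + q^ j * q^∸1 (suc j) * ((x + q^ (suc j)) * f 0 j)
          + T * q^ (suc j) * f (suc j) 0
          + T * q^ j * ((x + q^ (suc j)) * f j 0)
        expand x y f = solve 10 (λ p T x y b u v w g h → let o = con 0 in
          x :* ((q (up p b) :* v :+ q b :* up p b :* u) :+ T :* (q b :* g))
          :+ (q o :* (((q (up p (up p b)) :* w :+ q (up p b) :* up p (up p b) :* v) :+ T :* (q (up p b) :* h))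
                      :+ q (up p b) :* ((q (up p b) :* v :+ q b :* up p b :* u) :+ T :* (q b :* g)))
              :+ y :* (q o :* (w :+ q (up p b) :* v)))
          := (q (up p (up p b)) :+ y) :* w :+ (q (up p b) :* (x :+ y) :+ (q (up p b) :* up p (up p b) :+ q (up p b) :* q (up p b))) :* v
             :+ q b :* up p b :* ((x :+ q (up p b)) :* u) :+ T :* q (up p b) :* h :+ T :* q b :* ((x :+ q (up p b)) :* g))
          refl p T x y (q^∸1 j) (f 0 j) (f 0 (suc j)) (f 0 (suc (suc j))) (f j 0) (f (suc j) 0)
      next-twisted (suc i) zero = resp (expand x y f) (trans (expand y x f′) (+-congʳ (+-congʳ (+-congˡ (*-congʳ (+-congʳ (*-congˡ (+-comm y x))))))))
        (scale _ (lower (trans (*-comm _ _) (trans (sym (q^-+ (suc i) 1)) (reflexive (≡.cong q^ (ℕ.+-suc (suc i) 0))))) (cast (ℕ.+-suc (suc i) 0) (IH (suc i) 1)))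
          ⟨+⟩ scale _ (IH (suc i) 0)
          ⟨+⟩ scale _ (raise (reflexive (≡.cong (λ n → q^ (suc n)) (≡.sym (ℕ.+-identityʳ i)))) (IH i 0))
          ⟨+⟩ scale _ (cast (ℕ.+-suc i 0) (IH i 1)))
        where
        expand : ∀ x y f → next x y T f (suc i) 0 ≈
          q^ (suc i) * ((q^ 1 * q^ (suc i) + y) * f (suc i) 1)
          + (q^ (suc i) * (x + y) + q^ (suc i) * q^ (suc i) * q^ 1) * f (suc i) 0
          + q^ i * q^ (suc i) * ((x + q^ (suc i)) * f i 0)
          + q^ i * q^ (suc i) * q^ (suc i) * f i 1
        expand x y f = solve 8 (λ p x y a u v g h → let o = con 0 in
          x :* ((q (up p a) :* u :+ q a :* up p a :* g) :+ q a :* g)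
          :+ (q (up p a) :* (((q (up p a) :* (q (up p o) :* v :+ q o :* up p o :* u) :+ q a :* up p a :* h) :+ q a :* h)
                           :+ q o :* ((q (up p a) :* u :+ q a :* up p a :* g) :+ q a :* g))
              :+ y :* (q (up p a) :* (v :+ q o :* u)))
          := q (up p a) :* ((q (up p o) :* q (up p a) :+ y) :* v) :+ (q (up p a) :* (x :+ y) :+ q (up p a) :* q (up p a) :* q (up p o)) :* u
             :+ q a :* q (up p a) :* ((x :+ q (up p a)) :* g) :+ q a :* q (up p a) :* q (up p a) :* h)
          refl p x y (q^∸1 i) (f (suc i) 0) (f (suc i) 1) (f i 0) (f i 1)
      next-twisted (suc i) (suc j) = resp (expand x y f) (trans (expand y x f′) (+-congʳ (+-congʳ (+-congʳ (+-congˡ (*-congʳ (+-congʳ (*-congˡ (+-comm y x)))))))))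
        (scale _ (lower (trans (sym (q^-+ (suc i) (suc (suc j)))) (reflexive (≡.cong q^ (ℕ.+-suc (suc i) (suc j))))) (cast (ℕ.+-suc (suc i) (suc j)) (IH (suc i) (suc (suc j)))))
          ⟨+⟩ scale _ (IH (suc i) (suc j))
          ⟨+⟩ scale _ (raise (sym (q^-+ (suc i) (suc j))) (cast (≡.sym (ℕ.+-suc i j)) (IH (suc i) j)))
          ⟨+⟩ scale _ (raise (sym (q^-+ (suc i) (suc j))) (IH i (suc j)))
          ⟨+⟩ scale _ (cast (ℕ.+-suc i (suc j)) (IH i (suc (suc j)))))
        where
        expand : ∀ x y f → next x y T f (suc i) (suc j) ≈
          q^ (suc i) * ((q^ (suc i) * q^ (suc (suc j)) + y) * f (suc i) (suc (suc j)))
          + (q^ (suc i) * q^ (suc j) * (x + y) + q^ (suc i) * q^ (suc i) * q^ (suc j) * (q^∸1 (suc (suc j)) + q^ (suc j))) * f (suc i) (suc j)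
          + q^ (suc i) * q^ j * q^∸1 (suc j) * ((x + q^ (suc i) * q^ (suc j)) * f (suc i) j)
          + q^ i * q^ (suc i) * ((x + q^ (suc i) * q^ (suc j)) * f i (suc j))
          + q^ i * q^ (suc i) * q^ (suc i) * f i (suc (suc j))
        expand x y f = solve 10 (λ p x y a b u v w g h → let qi = q (up p a) ; qj = q (up p b) in
          x :* ((qi :* (qj :* v :+ q b :* up p b :* u) :+ q a :* up p a :* g) :+ q a :* g)
          :+ (qi :* (((qi :* (q (up p (up p b)) :* w :+ qj :* up p (up p b) :* v) :+ q a :* up p a :* h) :+ q a :* h)
                     :+ qj :* ((qi :* (qj :* v :+ q b :* up p b :* u) :+ q a :* up p a :* g) :+ q a :* g))
              :+ y :* (qi :* (w :+ qj :* v)))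
          := qi :* ((qi :* q (up p (up p b)) :+ y) :* w) :+ (qi :* qj :* (x :+ y) :+ qi :* qi :* qj :* (up p (up p b) :+ qj)) :* v
             :+ qi :* q b :* up p b :* ((x :+ qi :* qj) :* u) :+ q a :* qi :* ((x :+ qi :* qj) :* g) :+ q a :* qi :* qi :* h)
          refl p x y (q^∸1 i) (q^∸1 j) (f (suc i) j) (f (suc i) (suc j)) (f (suc i) (suc (suc j))) (f i (suc j)) (f i (suc (suc j)))

    coeff-twisted : ∀ r i j → Twisted (i ℕ.+ j) (Coefficients.coeff x y r i j) (Coefficients.coeff y x r i j)
    coeff-twisted zero    zero    zero    = twisted refl
    coeff-twisted zero    zero    (suc j) = twisted (trans (zeroʳ _) (sym (zeroʳ _)))
    coeff-twisted zero    (suc i) j       = twisted (trans (zeroʳ _) (sym (zeroʳ _)))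
    coeff-twisted (suc r) = next-twisted (t^ (suc r)) (coeff-twisted r)

    coeff-symmetric : ∀ r → Coefficients.coeff x y r 0 0 ≈ Coefficients.coeff y x r 0 0
    coeff-symmetric r = trans (sym (*-identityˡ _)) (trans (balance (coeff-twisted r 0 0)) (*-identityˡ _))

open ≡ using (refl; sym; trans; cong; cong₂; subst; _≢_; module ≡-Reasoning)

-- Polynomials in the four statistics, acting by translation.

record Stat : Set where
  constructor stat
  field
    peaks rises cells labels : ℕ

data Mark : Set where
  peak♯ rise♯ cell♯ label♯ : Mark

inc : Mark → Stat → Stat
inc peak♯  (stat a b A B) = stat (suc a) b A B
inc rise♯  (stat a b A B) = stat a (suc b) A B
inc cell♯  (stat a b A B) = stat a b (suc A) B
inc label♯ (stat a b A B) = stat a b A (suc B)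

addCells addLabels : ℕ → Stat → Stat
addCells  k (stat a b A B) = stat a b (k ℕ.+ A) B
addLabels k (stat a b A B) = stat a b A (k ℕ.+ B)

_≟ˢ_ : (s u : Stat) → Dec (s ≡ u)
stat a b A B ≟ˢ stat a′ b′ A′ B′ =
  map′ (λ { (refl , refl , refl , refl) → refl }) (λ { refl → refl , refl , refl , refl })
    ((a ℕ.≟ a′) ×-dec (b ℕ.≟ b′) ×-dec (A ℕ.≟ A′) ×-dec (B ℕ.≟ B′))

data Poly : Set where
  gen     : Mark → Poly
  −1ᴾ 0ᴾ 1ᴾ : Poly
  _⊞_ _⊠_ : Poly → Poly → Poly

-- Polynomials act on functions of the exponents by translation, so the
-- coefficient of a monomial u is the value at the origin of the action on the
-- indicator function of u, and Poly need not be reduced to normal forms.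
act : Poly → (Stat → ℤ) → Stat → ℤ
act (gen g) M s = M (inc g s)
act −1ᴾ     M s = ℤ.- M s
act 0ᴾ      M s = 0ℤ
act 1ᴾ      M s = M s
act (P ⊞ Q) M s = act P M s ℤ.+ act Q M s
act (P ⊠ Q) M s = act P (act Q M) s

infix 4 _≈_
record _≈_ (P Q : Poly) : Set where
  constructor same
  field acts : ∀ M s → act P M s ≡ act Q M s
open _≈_

inc-comm : ∀ g h s → inc g (inc h s) ≡ inc h (inc g s)
inc-comm peak♯  peak♯  s = refl
inc-comm peak♯  rise♯  s = refl
inc-comm peak♯  cell♯  s = refl
inc-comm peak♯  label♯ s = refl
inc-comm rise♯  peak♯  s = refl
inc-comm rise♯  rise♯  s = refl
inc-comm rise♯  cell♯  s = refl
inc-comm rise♯  label♯ s = refl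
inc-comm cell♯  peak♯  s = refl
inc-comm cell♯  rise♯  s = refl
inc-comm cell♯  cell♯  s = refl
inc-comm cell♯  label♯ s = refl
inc-comm label♯ peak♯  s = refl
inc-comm label♯ rise♯  s = refl
inc-comm label♯ cell♯  s = refl
inc-comm label♯ label♯ s = refl

act-cong : ∀ P {M M′} → (∀ s → M s ≡ M′ s) → ∀ s → act P M s ≡ act P M′ s
act-cong (gen g) h s = h (inc g s)
act-cong −1ᴾ     h s = cong ℤ.-_ (h s)
act-cong 0ᴾ      h s = refl
act-cong 1ᴾ      h s = h s
act-cong (P ⊞ Q) h s = cong₂ ℤ._+_ (act-cong P h s) (act-cong Q h s)
act-cong (P ⊠ Q) h s = act-cong P (act-cong Q h) s

act-+ : ∀ P M M′ s → act P (λ s → M s ℤ.+ M′ s) s ≡ act P M s ℤ.+ act P M′ s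
act-+ (gen g) M M′ s = refl
act-+ −1ᴾ     M M′ s = ℤ.neg-distrib-+ (M s) (M′ s)
act-+ 0ᴾ      M M′ s = refl
act-+ 1ᴾ      M M′ s = refl
act-+ (P ⊞ Q) M M′ s = trans (cong₂ ℤ._+_ (act-+ P M M′ s) (act-+ Q M M′ s)) (interchange (act P M s) (act P M′ s) (act Q M s) (act Q M′ s))
  where
  open import Algebra.Properties.CommutativeSemigroup ℤ.+-commutativeSemigroup using (interchange)
act-+ (P ⊠ Q) M M′ s = trans (act-cong P (act-+ Q M M′) s) (act-+ P (act Q M) (act Q M′) s)

act-neg : ∀ P M s → act P (λ s → ℤ.- M s) s ≡ ℤ.- act P M s
act-neg (gen g) M s = refl
act-neg −1ᴾ     M s = refl
act-neg 0ᴾ      M s = refl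
act-neg 1ᴾ      M s = refl
act-neg (P ⊞ Q) M s = trans (cong₂ ℤ._+_ (act-neg P M s) (act-neg Q M s)) (sym (ℤ.neg-distrib-+ (act P M s) (act Q M s)))
act-neg (P ⊠ Q) M s = trans (act-cong P (act-neg Q M) s) (act-neg P (act Q M) s)

act-0 : ∀ P s → act P (λ _ → 0ℤ) s ≡ 0ℤ
act-0 (gen g) s = refl
act-0 −1ᴾ     s = refl
act-0 0ᴾ      s = refl
act-0 1ᴾ      s = refl
act-0 (P ⊞ Q) s = cong₂ ℤ._+_ (act-0 P s) (act-0 Q s)
act-0 (P ⊠ Q) s = trans (act-cong P (act-0 Q) s) (act-0 P s)

act-inc : ∀ P g M s → act P M (inc g s) ≡ act P (λ s → M (inc g s)) s
act-inc (gen h) g M s = cong M (inc-comm h g s)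
act-inc −1ᴾ     g M s = refl
act-inc 0ᴾ      g M s = refl
act-inc 1ᴾ      g M s = refl
act-inc (P ⊞ Q) g M s = cong₂ ℤ._+_ (act-inc P g M s) (act-inc Q g M s)
act-inc (P ⊠ Q) g M s = trans (act-inc P g (act Q M) s) (act-cong P (act-inc Q g M) s)

-- Exponents can be raised in any order, so translations commute with every action. The other cases
-- of P follow because every action is additive.
act-comm : ∀ P Q M s → act P (act Q M) s ≡ act Q (act P M) s
act-comm (gen g) Q M s = act-inc Q g M s
act-comm −1ᴾ     Q M s = sym (act-neg Q M s)
act-comm 0ᴾ      Q M s = sym (act-0 Q s)
act-comm 1ᴾ      Q M s = refl
act-comm (P ⊞ P′) Q M s = trans (cong₂ ℤ._+_ (act-comm P Q M s) (act-comm P′ Q M s)) (sym (act-+ Q (act P M) (act P′ M) s))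
act-comm (P ⊠ P′) Q M s = trans (act-cong P (act-comm P′ Q M) s) (act-comm P Q (act P′ M) s)

polySemiring : CommutativeSemiring _ _
polySemiring = record
  { Carrier = Poly ; _≈_ = _≈_ ; _+_ = _⊞_ ; _*_ = _⊠_ ; 0# = 0ᴾ ; 1# = 1ᴾ
  ; isCommutativeSemiring = record
    { isSemiring = record
      { isSemiringWithoutAnnihilatingZero = record
        { +-isCommutativeMonoid = record
          { isMonoid = record
            { isSemigroup = record
              { isMagma = record
                { isEquivalence = record
                  { refl = same λ M s → refl
                  ; sym = λ h → same λ M s → sym (acts h M s)
                  ; trans = λ h k → same λ M s → trans (acts h M s) (acts k M s) }
                ; ∙-cong = λ h k → same λ M s → cong₂ ℤ._+_ (acts h M s) (acts k M s) }
              ; assoc = λ P Q R → same λ M s → ℤ.+-assoc (act P M s) (act Q M s) (act R M s) }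
            ; identity = (λ P → same λ M s → ℤ.+-identityˡ (act P M s)) , (λ P → same λ M s → ℤ.+-identityʳ (act P M s)) }
          ; comm = λ P Q → same λ M s → ℤ.+-comm (act P M s) (act Q M s) }
        ; *-cong = λ {P} {P′} {Q} {Q′} h k → same λ M s → trans (act-cong P (acts k M) s) (acts h (act Q′ M) s)
        ; *-assoc = λ P Q R → same λ M s → refl
        ; *-identity = (λ P → same λ M s → refl) , (λ P → same λ M s → refl)
        ; distrib = (λ P Q R → same λ M s → act-+ P (act Q M) (act R M) s) , (λ P Q R → same λ M s → refl) }
      ; zero = (λ P → same λ M s → refl) , (λ P → same λ M s → act-0 P s) }
    ; *-comm = λ P Q → same λ M s → act-comm P Q M s } }

-- With p = q - 1, where q marks a cell, 1 + p is q itself. This is why `Poly` has -1.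
open Transform polySemiring (gen cell♯ ⊞ −1ᴾ) (gen label♯)

-- A factor 1 + (q - 1) is split off; its action z + (z′ - z) cancels to z′, with one more cell.
act-q^ : ∀ k M s → act (q^ k) M s ≡ M (addCells k s)
act-q^ zero    M s = ℤ.+-identityʳ (M s)
act-q^ (suc k) M s@(stat a b A B) = begin
  act (q^ (suc k)) M s                  ≡⟨ acts (q^-suc k) M s ⟩
  z ℤ.+ (z′ ℤ.+ ℤ.- z)                  ≡⟨ cong (λ v → z ℤ.+ v) (ℤ.+-comm z′ (ℤ.- z)) ⟩
  z ℤ.+ (ℤ.- z ℤ.+ z′)                  ≡⟨ ℤ.+-assoc z (ℤ.- z) z′ ⟨
  z ℤ.+ ℤ.- z ℤ.+ z′                    ≡⟨ cong (ℤ._+ z′) (ℤ.+-inverseʳ z) ⟩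
  0ℤ ℤ.+ z′                             ≡⟨ ℤ.+-identityˡ z′ ⟩
  z′                                    ≡⟨ act-q^ k M (inc cell♯ s) ⟩
  M (stat a b (k ℕ.+ suc A) B)          ≡⟨ cong (λ A → M (stat a b A B)) (ℕ.+-suc k A) ⟩
  M (addCells (suc k) s) ∎
  where
  open ≡-Reasoning
  z z′ : ℤ
  z  = act (q^ k) M s
  z′ = act (q^ k) M (inc cell♯ s)

act-t^ : ∀ k M s → act (t^ k) M s ≡ M (addLabels k s)
act-t^ zero    M s = refl
act-t^ (suc k) M s@(stat a b A B) =
  trans (act-t^ k M (inc label♯ s)) (cong (λ B → M (stat a b A B)) (ℕ.+-suc k B))

-- Finite sets counted by integers.

indicator : ∀ {X : Set} → Dec X → ℤ
indicator (yes _) = ℤ.+ 1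
indicator (no _)  = ℤ.+ 0

at : Stat → Stat → ℤ
at u s = indicator (s ≟ˢ u)

-- The count z stays an integer because it is produced by an action on functions to ℤ. That it is a
-- natural number is part of the data, so two sets with the same z are in bijection.
Enumerated : Set → ℤ → Set
Enumerated X z = Σ ℕ λ k → (X ↔ Fin k) × z ≡ ℤ.+ k

enumerated-⊎ : ∀ {X Y y z} → Enumerated X y → Enumerated Y z → Enumerated (X ⊎ Y) (y ℤ.+ z)
enumerated-⊎ (k , X↔ , refl) (l , Y↔ , refl) = k ℕ.+ l , (↔-sym +↔⊎ ↔-∘ (X↔ ⊎-↔ Y↔)) , refl

enumerated-resp : ∀ {X Y y z} → X ↔ Y → y ≡ z → Enumerated Y z → Enumerated X y
enumerated-resp X↔Y refl (k , Y↔ , e) = k , (Y↔ ↔-∘ X↔Y) , e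

enumerated-≡ : ∀ {s u : Stat} (d : Dec (s ≡ u)) → Enumerated (s ≡ u) (indicator d)
enumerated-≡ (yes refl) = 1 , mk↔ₛ′ (λ _ → zero) (λ _ → refl) (λ { zero → refl }) (λ { refl → refl }) , refl
enumerated-≡ (no s≢u)   = 0 , mk↔ₛ′ (λ h → ⊥-elim (s≢u h)) (λ ()) (λ ()) (λ h → ⊥-elim (s≢u h)) , refl

enumerated⇒↔ : ∀ {X Y z} → Enumerated X z → Enumerated Y z → X ↔ Y
enumerated⇒↔ (k , X↔ , refl) (.k , Y↔ , refl) = ↔-sym Y↔ ↔-∘ X↔

-- Walks and their enumeration.

-- In Walk r e m, r + 1 rows remain to be read, e columns of the current level of
-- the bounce path remain to be crossed, and m rows of this level without
-- decorated peak have been read; the height over the diagonal is e + m.  An east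
-- step at e = 0 starts the next level.  A north step is the start of a decorated
-- peak (star), a decorated rise (prime) or neither (plain, last), and a NorthWalk
-- starts with one.
mutual
  data NorthWalk : ℕ → ℕ → ℕ → Set where
    last  : ∀ {e m} → NorthWalk 0 e m
    star  : ∀ {r e m} → Walk r e m → NorthWalk (suc r) e m
    plain : ∀ {r e m} → Walk r e (suc m) → NorthWalk (suc r) e m
    prime : ∀ {r e m} → NorthWalk r e (suc m) → NorthWalk (suc r) e m

  data Walk : ℕ → ℕ → ℕ → Set where
    north : ∀ {r e m} → NorthWalk r e m → Walk r e m
    east  : ∀ {r e m} → Walk r e m → Walk r (suc e) m
    turn  : ∀ {r m} → Walk r m 0 → Walk r 0 (suc m)

module Count (g h : Mark) where

  mutual
    statN : ∀ {r e m} → NorthWalk r e m → Stat → Stat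
    statN last      s = s
    statN (star w)  s = statW w (inc g s)
    statN (plain w) s = statW w s
    statN (prime w) s = statN w (inc h s)

    statW : ∀ {r e m} → Walk r e m → Stat → Stat
    statW (north {e = e} {m} w) s = statN w (addCells (e ℕ.+ m) s)
    statW (east w)              s = statW w s
    -- After a turn, the labels of all r + 1 remaining rows go up by one.
    statW (turn {r} w)          s = statW w (addLabels (suc r) s)

  open Coefficients (gen g) (gen h)

  FibreN FibreW : ℕ → ℕ → ℕ → Stat → Stat → Set
  FibreN r e m u s = Σ (NorthWalk r e m) λ w → statN w s ≡ u
  FibreW r e m u s = Σ (Walk r e m) λ w → statW w s ≡ u

  last-↔ : ∀ {e m u s} → FibreN 0 e m u s ↔ (s ≡ u)
  last-↔ = mk↔ₛ′ (λ { (last , h) → h }) (λ h → last , h) (λ _ → refl) (λ { (last , h) → refl })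

  letter-↔ : ∀ {r e m u s} → FibreN (suc r) e m u s ↔
    (FibreW r e m u (inc g s) ⊎ (FibreW r e (suc m) u s ⊎ FibreN r e (suc m) u (inc h s)))
  letter-↔ = mk↔ₛ′
    (λ { (star w , h) → inj₁ (w , h) ; (plain w , h) → inj₂ (inj₁ (w , h)) ; (prime w , h) → inj₂ (inj₂ (w , h)) })
    (λ { (inj₁ (w , h)) → star w , h ; (inj₂ (inj₁ (w , h))) → plain w , h ; (inj₂ (inj₂ (w , h))) → prime w , h })
    (λ { (inj₁ (w , h)) → refl ; (inj₂ (inj₁ (w , h))) → refl ; (inj₂ (inj₂ (w , h))) → refl })
    (λ { (star w , h) → refl ; (plain w , h) → refl ; (prime w , h) → refl })

  origin-↔ : ∀ {r u s} → FibreW r 0 0 u s ↔ FibreN r 0 0 u s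
  origin-↔ = mk↔ₛ′ (λ { (north w , h) → w , h }) (λ { (w , h) → north w , h }) (λ _ → refl) (λ { (north w , h) → refl })

  east-↔ : ∀ {r e m u s} → FibreW r (suc e) m u s ↔
    (FibreN r (suc e) m u (addCells (suc e ℕ.+ m) s) ⊎ FibreW r e m u s)
  east-↔ = mk↔ₛ′
    (λ { (north w , h) → inj₁ (w , h) ; (east w , h) → inj₂ (w , h) })
    (λ { (inj₁ (w , h)) → north w , h ; (inj₂ (w , h)) → east w , h })
    (λ { (inj₁ _) → refl ; (inj₂ _) → refl })
    (λ { (north w , h) → refl ; (east w , h) → refl })

  turn-↔ : ∀ {r m u s} → FibreW r 0 (suc m) u s ↔
    (FibreN r 0 (suc m) u (addCells (suc m) s) ⊎ FibreW r m 0 u (addLabels (suc r) s))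
  turn-↔ = mk↔ₛ′
    (λ { (north w , h) → inj₁ (w , h) ; (turn w , h) → inj₂ (w , h) })
    (λ { (inj₁ (w , h)) → north w , h ; (inj₂ (w , h)) → turn w , h })
    (λ { (inj₁ _) → refl ; (inj₂ _) → refl })
    (λ { (north w , h) → refl ; (turn w , h) → refl })

  full : ℕ → Array
  full r = Round.full (t^ (suc r)) (coeff r)

  mutual
    -- Each monomial of a generating function moves s by its exponents, so the action on `at u`,
    -- taken at s, counts the walks that carry s to u. The recursions for `transform` match the
    -- constructors of walks.
    enumerateN : ∀ r e m u s → Enumerated (FibreN r e m u s) (act (transform (coeff r) e m) (at u) s)
    enumerateN zero e m u s =
      enumerated-resp last-↔ (acts (transform-coeff0 (λ i j → same λ M s → refl) e m) (at u) s) (enumerated-≡ (s ≟ˢ u))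
    enumerateN (suc r) e m u s =
      enumerated-resp letter-↔ (acts (transform-next (t^ (suc r)) (coeff r) e m) (at u) s)
        (enumerated-⊎ (enumerateW r e m u (inc g s))
          (enumerated-⊎ (enumerateW r e (suc m) u s) (enumerateN r e (suc m) u (inc h s))))

    -- A turn replaces (0 , m + 1) by (m , 0). Starts of levels therefore have a recursion of their
    -- own, on e alone, which keeps the whole recursion structural.
    enumerateLevel : ∀ r e u s → Enumerated (FibreW r e 0 u s) (act (transform (full r) e 0) (at u) s)
    enumerateLevel r zero u s =
      enumerated-resp origin-↔ (acts (full-origin (t^ (suc r)) (coeff r)) (at u) s) (enumerateN r 0 0 u s)
    enumerateLevel r (suc e) u s = enumerateEast r e 0 u s (enumerateLevel r e u s)

    -- The count after the east step is an argument, since it comes from either of two recursions.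
    enumerateEast : ∀ r e m u s → Enumerated (FibreW r e m u s) (act (transform (full r) e m) (at u) s) →
      Enumerated (FibreW r (suc e) m u s) (act (transform (full r) (suc e) m) (at u) s)
    enumerateEast r e m u s rec =
      enumerated-resp east-↔
        (trans (acts (Round.full-east (t^ (suc r)) (coeff r) e m) (at u) s)
          (cong (ℤ._+ act (transform (full r) e m) (at u) s) (act-q^ (suc e ℕ.+ m) (act (transform (coeff r) (suc e) m) (at u)) s)))
        (enumerated-⊎ (enumerateN r (suc e) m u _) rec)

    enumerateW : ∀ r e m u s → Enumerated (FibreW r e m u s) (act (transform (full r) e m) (at u) s)
    enumerateW r (suc e) m    u s = enumerateEast r e m u s (enumerateW r e m u s)
    enumerateW r zero zero    u s = enumerateLevel r zero u s
    enumerateW r zero (suc m) u s =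
      enumerated-resp turn-↔
        (trans (acts (full-turn (t^ (suc r)) (coeff r) m) (at u) s)
          (cong₂ ℤ._+_ (act-q^ (suc m) (act (transform (coeff r) 0 (suc m)) (at u)) s)
            (act-t^ (suc r) (act (transform (full r) m 0) (at u)) s)))
        (enumerated-⊎ (enumerateN r 0 (suc m) u _) (enumerateLevel r m u _))

module PR = Count peak♯ rise♯
module RP = Count rise♯ peak♯

abstract
  -- Both fibres are counted by the coefficient of index (0 , 0), with x and y exchanged. Being
  -- abstract, the bijection is never unfolded into the enumeration.
  fibre-symmetry : ∀ r u s → PR.FibreN r 0 0 u s ↔ RP.FibreN r 0 0 u s
  fibre-symmetry r u s = enumerated⇒↔ (PR.enumerateN r 0 0 u s)
    (enumerated-resp ↔-refl
      (acts (Twist.coeff-symmetric (gen peak♯) (gen rise♯) r) (at u) s) (RP.enumerateN r 0 0 u s))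

open import Data.Nat using (_+_; _*_; _∸_; _<ᵇ_; _<_; z≤n; s≤s)
open import Data.Nat.Properties using (+-suc; +-comm; +-assoc; +-identityʳ; suc-injective; m+n∸n≡m; m+n∸m≡n)

-- Walks as codes of decorated paths.

mutual
  pathN : ∀ {r e m} → NorthWalk r e m → List Step
  pathN (last {e} {m}) = N ∷ replicate (suc (e + m)) E
  pathN (star w)       = N ∷ E ∷ pathW w
  pathN (plain w)      = N ∷ pathW w
  pathN (prime w)      = N ∷ pathN w

  pathW : ∀ {r e m} → Walk r e m → List Step
  pathW (north w) = pathN w
  pathW (east w)  = E ∷ pathW w
  pathW (turn w)  = E ∷ pathW w

mutual
  peaksN : ∀ {r e m} → NorthWalk r e m → Vec Bool (suc r)
  peaksN last      = false ∷ []
  peaksN (star w)  = true ∷ peaksW w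
  peaksN (plain w) = false ∷ peaksW w
  peaksN (prime w) = false ∷ peaksN w

  peaksW : ∀ {r e m} → Walk r e m → Vec Bool (suc r)
  peaksW (north w) = peaksN w
  peaksW (east w)  = peaksW w
  peaksW (turn w)  = peaksW w

mutual
  risesN : ∀ {r e m} → NorthWalk r e m → Vec Bool (suc r)
  risesN last      = false ∷ []
  risesN (star w)  = false ∷ risesW w
  risesN (plain w) = false ∷ risesW w
  risesN (prime w) = true ∷ risesN w

  risesW : ∀ {r e m} → Walk r e m → Vec Bool (suc r)
  risesW (north w) = risesN w
  risesW (east w)  = risesW w
  risesW (turn w)  = risesW w

Code : ℕ → Set
Code r = List Step × Vec Bool (suc r) × Vec Bool (suc r)

codeN : ∀ {r e m} → NorthWalk r e m → Code r
codeN w = pathN w , peaksN w , risesN w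

codeW : ∀ {r e m} → Walk r e m → Code r
codeW w = pathW w , peaksW w , risesW w

pathN-north : ∀ {r e m} (w : NorthWalk r e m) {s} → pathN w ≢ E ∷ s
pathN-north last ()
pathN-north (star w) ()
pathN-north (plain w) ()
pathN-north (prime w) ()

mutual
  -- The decorations of the row tell `star`, `prime` and `plain` apart, the next step tells `north`
  -- from the rest, and e decides between `east` and `turn`.
  codeN-injective : ∀ {r e m} (w w′ : NorthWalk r e m) →
    pathN w ≡ pathN w′ → peaksN w ≡ peaksN w′ → risesN w ≡ risesN w′ → w ≡ w′
  codeN-injective last      last       p k l = refl
  codeN-injective (star w)  (star w′)  p k l = cong star (codeW-injective w w′ (List.∷-injectiveʳ (List.∷-injectiveʳ p)) (Vec.∷-injectiveʳ k) (Vec.∷-injectiveʳ l))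
  codeN-injective (star w)  (plain w′) p () l
  codeN-injective (star w)  (prime w′) p () l
  codeN-injective (plain w) (star w′)  p () l
  codeN-injective (plain w) (plain w′) p k l = cong plain (codeW-injective w w′ (List.∷-injectiveʳ p) (Vec.∷-injectiveʳ k) (Vec.∷-injectiveʳ l))
  codeN-injective (plain w) (prime w′) p k ()
  codeN-injective (prime w) (star w′)  p () l
  codeN-injective (prime w) (plain w′) p k ()
  codeN-injective (prime w) (prime w′) p k l = cong prime (codeN-injective w w′ (List.∷-injectiveʳ p) (Vec.∷-injectiveʳ k) (Vec.∷-injectiveʳ l))

  codeW-injective : ∀ {r e m} (w w′ : Walk r e m) →
    pathW w ≡ pathW w′ → peaksW w ≡ peaksW w′ → risesW w ≡ risesW w′ → w ≡ w′
  codeW-injective (north w) (north w′) p k l = cong north (codeN-injective w w′ p k l)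
  codeW-injective (north w) (east w′)  p k l with () ← pathN-north w p
  codeW-injective (north w) (turn w′)  p k l with () ← pathN-north w p
  codeW-injective (east w)  (north w′) p k l with () ← pathN-north w′ (sym p)
  codeW-injective (east w)  (east w′)  p k l = cong east (codeW-injective w w′ (List.∷-injectiveʳ p) k l)
  codeW-injective (turn w)  (north w′) p k l with () ← pathN-north w′ (sym p)
  codeW-injective (turn w)  (turn w′)  p k l = cong turn (codeW-injective w w′ (List.∷-injectiveʳ p) k l)

-- Validity of a code started at height d over the diagonal.
record Admissible (r d : ℕ) (c : Code r) : Set where
  constructor admissible
  private
    p = proj₁ c
    k = toList (proj₁ (proj₂ c))
    l = toList (proj₂ (proj₂ c))
  field
    above  : T (aboveDiag d p)
    norths : countN p ≡ suc r
    easts  : countE p ≡ d + suc r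
    peaks⊆ : T (k ⊆ᵇ peakFlags p)
    rises⊆ : T (l ⊆ᵇ riseFlags p)
    plain-last : T (lastFalse k)

replicate-E : ∀ p → countN p ≡ 0 → p ≡ replicate (countE p) E
replicate-E []      h = refl
replicate-E (E ∷ p) h = cong (E ∷_) (replicate-E p h)

lastFalse-tail : ∀ {n b} (k : Vec Bool (suc n)) → T (lastFalse (b ∷ toList k)) → T (lastFalse (toList k))
lastFalse-tail (_ ∷ _) h = h

lastFalse-∷ : ∀ {n b} (k : Vec Bool (suc n)) → T (lastFalse (toList k)) → T (lastFalse (b ∷ toList k))
lastFalse-∷ (_ ∷ _) h = h

-- An undecorated row imposes no condition, whatever flag the next step gives it.
peaks-false : ∀ p k → ((false ∷ k) ⊆ᵇ peakFlags (N ∷ p)) ≡ (k ⊆ᵇ peakFlags p)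
peaks-false []      k = refl
peaks-false (N ∷ p) k = refl
peaks-false (E ∷ p) k = refl

rises-false : ∀ p l → ((false ∷ l) ⊆ᵇ riseFlags (N ∷ p)) ≡ (l ⊆ᵇ riseFlags p)
rises-false []      l = refl
rises-false (N ∷ p) l = refl
rises-false (E ∷ p) l = refl

mutual
  encodeN : ∀ {r} d e m p k l → d ≡ e + m → Admissible r d (N ∷ p , k , l) →
    Σ[ w ∈ NorthWalk r e m ] codeN w ≡ (N ∷ p , k , l)
  -- Only here is a decorated peak in the last row excluded.
  encodeN {zero} d e m p (true ∷ []) l h a with () ← Admissible.plain-last a
  encodeN {suc r} d e m (E ∷ p) (true ∷ k) (false ∷ l) h (admissible a n c pk rs pl) =
    let w , eq = encodeW d e m p k l h
          (admissible a (suc-injective n) (suc-injective (trans c (+-suc d (suc r)))) pk rs (lastFalse-tail k pl))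
    in star w , cong (λ (p , k , l) → N ∷ E ∷ p , true ∷ k , false ∷ l) eq
  encodeN {suc r} d e m (E ∷ p) (true ∷ k) (true ∷ l) h (admissible a n c pk () pl)
  encodeN {suc r} d e m [] (true ∷ k) l h (admissible a n c () rs pl)
  encodeN {suc r} d e m (N ∷ p) (true ∷ k) l h (admissible a n c () rs pl)
  encodeN d e m [] (false ∷ k) (true ∷ l) h (admissible a n c pk () pl)
  encodeN d e m (E ∷ p) (false ∷ k) (true ∷ l) h (admissible a n c pk () pl)
  encodeN {zero} d e m (N ∷ p) (false ∷ []) (true ∷ l) h (admissible a () c pk rs pl)
  encodeN {suc r} d e m (N ∷ p) (false ∷ k) (true ∷ l) h (admissible a n c pk rs pl) =
    let w , eq = encodeN (suc d) e (suc m) p k l (trans (cong suc h) (sym (+-suc e m)))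
          (admissible a (suc-injective n) (trans c (+-suc d (suc r))) pk rs (lastFalse-tail k pl))
    in prime w , cong (λ (p , k , l) → N ∷ p , false ∷ k , true ∷ l) eq
  -- No north step is left, so the number of east steps determines the rest of the path.
  encodeN {zero} d e m p (false ∷ []) (false ∷ []) refl (admissible a n c pk rs pl) =
    last , cong (λ p → N ∷ p , false ∷ [] , false ∷ [])
      (sym (trans (replicate-E p (suc-injective n)) (cong (λ j → replicate j E) (trans c (+-comm d 1)))))
  encodeN {suc r} d e m p (false ∷ k) (false ∷ l) h (admissible a n c pk rs pl) =
    let w , eq = encodeW (suc d) e (suc m) p k l (trans (cong suc h) (sym (+-suc e m)))
          (admissible a (suc-injective n) (trans c (+-suc d (suc r))) (subst T (peaks-false p (toList k)) pk) (subst T (rises-false p (toList l)) rs) (lastFalse-tail k pl))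
    in plain w , cong (λ (p , k , l) → N ∷ p , false ∷ k , false ∷ l) eq

  encodeW : ∀ {r} d e m p k l → d ≡ e + m → Admissible r d (p , k , l) →
    Σ[ w ∈ Walk r e m ] codeW w ≡ (p , k , l)
  encodeW d e m [] k l h (admissible a () c pk rs pl)
  encodeW d e m (N ∷ p) k l h a = let w , eq = encodeN d e m p k l h a in north w , eq
  encodeW zero e m (E ∷ p) k l h (admissible () n c pk rs pl)
  encodeW (suc d) (suc e) m (E ∷ p) k l h (admissible a n c pk rs pl) =
    let w , eq = encodeW d e m p k l (suc-injective h) (admissible a n (suc-injective c) pk rs pl)
    in east w , cong (λ (p , kl) → E ∷ p , kl) eq
  encodeW (suc d) zero (suc m) (E ∷ p) k l h (admissible a n c pk rs pl) =
    let w , eq = encodeW d m 0 p k l (trans (suc-injective h) (sym (+-identityʳ m))) (admissible a n (suc-injective c) pk rs pl)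
    in turn w , cong (λ (p , kl) → E ∷ p , kl) eq

subst-admissible : ∀ {r d d′ c} → d ≡ d′ → Admissible r d c → Admissible r d′ c
subst-admissible refl a = a

above-E : ∀ d → T (aboveDiag d (replicate d E))
above-E zero    = tt
above-E (suc d) = above-E d

countN-E : ∀ d → countN (replicate d E) ≡ 0
countN-E zero    = refl
countN-E (suc d) = countN-E d

countE-E : ∀ d → countE (replicate d E) ≡ d
countE-E zero    = refl
countE-E (suc d) = cong suc (countE-E d)

flags-E : ∀ d → peakFlags (replicate d E) ≡ [] × riseFlags (replicate d E) ≡ []
flags-E zero    = refl , refl
flags-E (suc d) = flags-E d

mutual
  admissibleN : ∀ {r e m} (w : NorthWalk r e m) → Admissible r (e + m) (codeN w)
  admissibleN (last {e} {m}) = admissible (above-E (suc (e + m)))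
    (cong suc (countN-E (suc (e + m)))) (trans (countE-E (suc (e + m))) (+-comm 1 (e + m)))
    (subst (λ f → T ((false ∷ []) ⊆ᵇ (true ∷ f))) (sym (proj₁ (flags-E (e + m)))) tt)
    (subst (λ f → T ((false ∷ []) ⊆ᵇ (false ∷ f))) (sym (proj₂ (flags-E (e + m)))) tt)
    tt
  admissibleN (star {r} {e} {m} w) with admissible a n c pk rs pl ← admissibleW w =
    admissible a (cong suc n) (trans (cong suc c) (sym (+-suc (e + m) (suc r)))) pk rs (lastFalse-∷ (peaksW w) pl)
  admissibleN (plain {r} {e} {m} w) with admissible a n c pk rs pl ← admissibleW w =
    admissible (subst (λ d → T (aboveDiag d (pathW w))) (+-suc e m) a) (cong suc n)
      (trans c (trans (cong (_+ suc r) (+-suc e m)) (sym (+-suc (e + m) (suc r)))))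
      (subst T (sym (peaks-false (pathW w) (toList (peaksW w)))) pk) (subst T (sym (rises-false (pathW w) (toList (risesW w)))) rs) (lastFalse-∷ (peaksW w) pl)
  -- The flags of the current row compute only once the next step is known to be north.
  admissibleN (prime {r} {e} {m} w) with pathN w | pathN-head w | admissibleN w
  ... | _ | p , refl | admissible a n c pk rs pl =
    admissible (subst (λ d → T (aboveDiag d (N ∷ p))) (+-suc e m) a) (cong suc n)
      (trans c (trans (cong (_+ suc r) (+-suc e m)) (sym (+-suc (e + m) (suc r)))))
      pk rs (lastFalse-∷ (peaksN w) pl)

  admissibleW : ∀ {r e m} (w : Walk r e m) → Admissible r (e + m) (codeW w)
  admissibleW (north w) = admissibleN w
  admissibleW (east w) with admissible a n c pk rs pl ← admissibleW w = admissible a n (cong suc c) pk rs pl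
  admissibleW (turn {r} {m} w) with admissible a n c pk rs pl ← subst-admissible (+-identityʳ m) (admissibleW w) =
    admissible a n (cong suc c) pk rs pl

  pathN-head : ∀ {r e m} (w : NorthWalk r e m) → Σ[ p ∈ List Step ] pathN w ≡ N ∷ p
  pathN-head last      = _ , refl
  pathN-head (star w)  = _ , refl
  pathN-head (plain w) = _ , refl
  pathN-head (prime w) = _ , refl

-- The area of a walk.

mutual
  -- The row after a decorated rise is entered as a `NorthWalk` and not through `north`, so its
  -- cells are left out.
  areaN : ∀ {r e m} → NorthWalk r e m → ℕ
  areaN last      = 0
  areaN (star w)  = areaW w
  areaN (plain w) = areaW w
  areaN (prime w) = areaN w

  areaW : ∀ {r e m} → Walk r e m → ℕ
  areaW (north {e = e} {m} w) = e + m + areaN w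
  areaW (east w)              = areaW w
  areaW (turn w)              = areaW w

mutual
  bounceN : ∀ {r e m} → NorthWalk r e m → ℕ
  bounceN last      = 0
  bounceN (star w)  = bounceW w
  bounceN (plain w) = bounceW w
  bounceN (prime w) = bounceN w

  bounceW : ∀ {r e m} → Walk r e m → ℕ
  bounceW (north w)    = bounceN w
  bounceW (east w)     = bounceW w
  bounceW (turn {r} w) = suc r + bounceW w

-- The area word of a walk; for a NorthWalk, without its first entry e + m, so
-- that the entries are aligned with the decorated rises.
mutual
  heightsN : ∀ {r e m} → NorthWalk r e m → List ℕ
  heightsN last                  = []
  heightsN (star w)              = heightsW w
  heightsN (plain w)             = heightsW w
  heightsN (prime {e = e} {m} w) = e + suc m ∷ heightsN w

  heightsW : ∀ {r e m} → Walk r e m → List ℕ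
  heightsW (north {e = e} {m} w) = e + m ∷ heightsN w
  heightsW (east w)              = heightsW w
  heightsW (turn w)              = heightsW w

areaWordFrom : (ℕ → ℕ) → ℕ → ℕ → List Step → List ℕ
areaWordFrom f r ε p = zipWith _∸_ (applyUpTo f r) (eastBefore ε p)

eastBefore-E : ∀ ε d → eastBefore ε (replicate d E) ≡ []
eastBefore-E ε zero    = refl
eastBefore-E ε (suc d) = eastBefore-E (suc ε) d

mutual
  -- Here f enumerates the remaining rows, counted from zero, and ε is the number of east steps
  -- read; generalising `upTo` to such an f makes the induction possible.
  areaWordN : ∀ {r e m} (w : NorthWalk r e m) (f : ℕ → ℕ) ε → (∀ i → f i ≡ ε + (e + m) + i) →
    areaWordFrom f (suc r) ε (pathN w) ≡ e + m ∷ heightsN w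
  areaWordN (last {e} {m}) f ε h =
    cong₂ _∷_ (height f ε h) (cong (zipWith _∸_ []) (eastBefore-E ε (suc (e + m))))
  areaWordN (star {e = e} {m} w) f ε h = cong₂ _∷_ (height f ε h)
    (areaWordW w (λ i → f (suc i)) (suc ε) (λ i → trans (h (suc i)) (+-suc (ε + (e + m)) i)))
  areaWordN (plain {e = e} {m} w) f ε h = cong₂ _∷_ (height f ε h)
    (areaWordW w (λ i → f (suc i)) ε (λ i → trans (h (suc i)) (shift ε e m i)))
  areaWordN (prime {e = e} {m} w) f ε h = cong₂ _∷_ (height f ε h)
    (areaWordN w (λ i → f (suc i)) ε (λ i → trans (h (suc i)) (shift ε e m i)))

  areaWordW : ∀ {r e m} (w : Walk r e m) (f : ℕ → ℕ) ε → (∀ i → f i ≡ ε + (e + m) + i) →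
    areaWordFrom f (suc r) ε (pathW w) ≡ heightsW w
  areaWordW (north w) f ε h = areaWordN w f ε h
  areaWordW (east {e = e} {m} w) f ε h = areaWordW w f (suc ε) (λ i → trans (h i) (cong (_+ i) (+-suc ε (e + m))))
  areaWordW (turn {m = m} w) f ε h = areaWordW w f (suc ε)
    (λ i → trans (h i) (cong (_+ i) (trans (+-suc ε m) (cong (λ m → suc ε + m) (sym (+-identityʳ m))))))

  height : ∀ {d} (f : ℕ → ℕ) ε → (∀ i → f i ≡ ε + d + i) → f 0 ∸ ε ≡ d
  height {d} f ε h = trans (cong (_∸ ε) (trans (h 0) (+-identityʳ (ε + d)))) (m+n∸m≡n ε d)

  shift : ∀ ε e m i → ε + (e + m) + suc i ≡ ε + (e + suc m) + i
  shift = solve 4 (λ ε e m i → ε :+ (e :+ m) :+ (con 1 :+ i) := ε :+ (e :+ (con 1 :+ m)) :+ i) refl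
    where open +-*-Solver

decoratedSum : List Bool → List ℕ → ℕ
decoratedSum l hs = sum (zipWith (λ r w → if r then w else 0) l hs)

decoratedSum-false : ∀ l hs → decoratedSum (false ∷ l) hs ≡ decoratedSum l (drop 1 hs)
decoratedSum-false l       (h ∷ hs) = refl
decoratedSum-false []      []       = refl
decoratedSum-false (_ ∷ _) []       = refl

mutual
  -- Each entry either counts in `areaN` or follows a decorated rise. The sum form postpones
  -- truncated subtraction to `codeArea-walk`.
  sum-heightsN : ∀ {r e m} (w : NorthWalk r e m) →
    sum (heightsN w) ≡ areaN w + decoratedSum (toList (risesN w)) (heightsN w)
  sum-heightsN last      = refl
  sum-heightsN (star w)  = trans (sum-heightsW w) (cong (areaW w +_) (sym (decoratedSum-false (toList (risesW w)) (heightsW w))))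
  sum-heightsN (plain w) = trans (sum-heightsW w) (cong (areaW w +_) (sym (decoratedSum-false (toList (risesW w)) (heightsW w))))
  sum-heightsN (prime {e = e} {m} w) = trans (cong (e + suc m +_) (sum-heightsN w))
    (solve 3 (λ a b c → a :+ (b :+ c) := b :+ (a :+ c)) refl (e + suc m) (areaN w) (decoratedSum (toList (risesN w)) (heightsN w)))
    where open +-*-Solver

  sum-heightsW : ∀ {r e m} (w : Walk r e m) →
    sum (heightsW w) ≡ areaW w + decoratedSum (toList (risesW w)) (drop 1 (heightsW w))
  sum-heightsW (north {e = e} {m} w) = trans (cong (e + m +_) (sum-heightsN w)) (sym (+-assoc (e + m) _ _))
  sum-heightsW (east w) = sum-heightsW w
  sum-heightsW (turn w) = sum-heightsW w

areaWord-walk : ∀ {r} (w : NorthWalk r 0 0) → areaWord (pathN w) ≡ 0 ∷ heightsN w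
areaWord-walk w = trans (cong (λ n → areaWordFrom (λ i → i) n 0 (pathN w)) (Admissible.norths (admissibleN w)))
  (areaWordN w (λ i → i) 0 (λ _ → refl))

codeArea : ∀ {r} → Code r → ℕ
codeArea (p , k , l) = sum (areaWord p) ∸ decoratedSum (toList l) (drop 1 (areaWord p))

codeArea-walk : ∀ {r} (w : NorthWalk r 0 0) → codeArea (codeN w) ≡ areaN w
codeArea-walk w = trans (cong (λ hs → sum hs ∸ decoratedSum (toList (risesN w)) (drop 1 hs)) (areaWord-walk w))
  (trans (cong (_∸ D) (sum-heightsN w)) (m+n∸n≡m (areaN w) D))
  where D = decoratedSum (toList (risesN w)) (heightsN w)

-- The second bounce path of a walk.

positive : ℕ → ℕ
positive zero    = 0
positive (suc _) = 1

eastHeights-E : ∀ h i j → nth (eastHeights h (barPath [] (replicate (suc (i + j)) E))) i ≡ h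
eastHeights-E h zero    j = refl
eastHeights-E h (suc i) j = eastHeights-E h i j

barPath-E : ∀ k p → barPath k (E ∷ p) ≡ E ∷ barPath k p
barPath-E []          p = refl
barPath-E (true ∷ k)  p = refl
barPath-E (false ∷ k) p = refl

<ᵇ-irrefl : ∀ a → (a <ᵇ a) ≡ false
<ᵇ-irrefl zero    = refl
<ᵇ-irrefl (suc a) = <ᵇ-irrefl a

module Loop (n : ℕ) (heights : List ℕ) (peaks : List Bool) where

  loop : ℕ → ℕ → ℕ → ℕ → ℕ
  loop F = bounceLoop F n heights peaks

  loop-end : ∀ F x y z k → nth heights x ≡ y + z → n ≡ y + z → loop (suc F) x y k ≡ k * z
  loop-end F x y z k h n≡ rewrite h | n≡ | <ᵇ-irrefl (y + z) | m+n∸m≡n y z = +-identityʳ (k * z)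

  loop-turn : ∀ F x y z k r P → nth heights x ≡ y + z → n ≡ y + z + suc r → countTrue (take (y + z) peaks) ≡ P →
    loop (suc F) x y k ≡ k * z + loop F (y + z ∸ P) (y + z) (suc k)
  loop-turn F x y z k r P h n≡ refl rewrite h | Equivalence.to T-≡ (ℕ.<⇒<ᵇ (subst (y + z <_) (sym n≡) (ℕ.m<m+n (y + z) (s≤s z≤n)))) | m+n∸m≡n y z = refl

  -- ρ rows and ε east steps of the bar path have been read, P of these rows are
  -- decorated peaks, and the current level started at height y.
  record Invariant (r e m : ℕ) (bar : List Step) (k : List Bool) (F x y z ρ ε P : ℕ) : Set where
    constructor invariant
    field
      heights-suffix : ∀ i → nth heights (ε + i) ≡ nth (eastHeights ρ bar) i
      peaks-suffix   : ∀ i → countTrue (take (ρ + i) peaks) ≡ P + countTrue (take i k)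
      x≡ : x ≡ ε + e
      ρ≡ : ρ ≡ ε + e + m + P
      yz : ρ ≡ y + z
      n≡ : n ≡ ρ + suc r
      -- A turn needs m > 0, so fuel exceeds the number of rows left before it.
      fuel : suc r + positive m ≤ F

  open +-*-Solver

  -- Reading a row releases one unit of fuel, which pays for the turn that this row may make
  -- possible.
  step-fuel : ∀ {r m m′ F} → suc (suc r) + positive m ≤ F → positive m′ ≤ 1 → suc r + positive m′ ≤ F
  step-fuel {r} {m} h h′ = ℕ.≤-trans (ℕ.+-monoʳ-≤ (suc r) h′) (ℕ.≤-trans (ℕ.≤-reflexive (+-comm (suc r) 1)) (ℕ.≤-trans (ℕ.m≤m+n (suc (suc r)) (positive m)) h))

  positive≤1 : ∀ m → positive m ≤ 1
  positive≤1 zero    = z≤n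
  positive≤1 (suc m) = s≤s z≤n

  mutual
    -- The z rows read in this level have label c, and the `suc r` rows ahead have at least c;
    -- `bounceN w` is the surplus due to later turns.
    loopN : ∀ {r e m} (w : NorthWalk r e m) {F x y z ρ ε P} c →
      Invariant r e m (barPath (toList (peaksN w)) (pathN w)) (toList (peaksN w)) F x y z ρ ε P →
      loop F x y c ≡ c * (z + suc r) + bounceN w
    loopN (last {e} {m}) {suc F} {y = y} {z} {ρ} {ε} c (invariant hs ps refl ρ≡ refl n≡ fuel) =
      trans (loop-end F (ε + e) y (z + 1) c
              -- Of the e + m + 1 final east steps, the one with index e lies at abscissa x; it
              -- starts at height `suc ρ`, which is n.
              (trans (hs e) (trans (eastHeights-E (suc ρ) e m) (trans (sym (+-comm ρ 1)) (+-assoc y z 1))))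
              (trans n≡ (+-assoc y z 1)))
        (sym (+-identityʳ _))
    loopN (star {r} {e} {m} w) {x = x} {y} {z} {ρ} {ε} {P} c (invariant hs ps x≡ ρ≡ yz n≡ fuel) =
      trans (loopW w c (invariant hs
          (λ i → trans (cong (λ j → countTrue (take j peaks)) (sym (+-suc ρ i))) (trans (ps (suc i)) (+-suc P _)))
          x≡ (trans (cong suc ρ≡) (sym (+-suc (ε + e + m) P))) (trans (cong suc yz) (sym (+-suc y z)))
          (trans n≡ (+-suc ρ (suc r))) (step-fuel {m = m} {m′ = m} fuel (positive≤1 m))))
        (cong (λ j → c * j + bounceW w) (sym (+-suc z (suc r))))
    loopN (plain {r} {e} {m} w) {x = x} {y} {z} {ρ} {ε} {P} c (invariant hs ps x≡ ρ≡ yz n≡ fuel) =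
      trans (loopW w c (invariant hs
          (λ i → trans (cong (λ j → countTrue (take j peaks)) (sym (+-suc ρ i))) (ps (suc i)))
          x≡ (trans (cong suc ρ≡) (next-column ε e m P)) (trans (cong suc yz) (sym (+-suc y z)))
          (trans n≡ (+-suc ρ (suc r))) (step-fuel {m = m} {m′ = suc m} fuel (positive≤1 (suc m)))))
        (cong (λ j → c * j + bounceW w) (sym (+-suc z (suc r))))
    loopN (prime {r} {e} {m} w) {x = x} {y} {z} {ρ} {ε} {P} c (invariant hs ps x≡ ρ≡ yz n≡ fuel) =
      trans (loopN w c (invariant hs
          (λ i → trans (cong (λ j → countTrue (take j peaks)) (sym (+-suc ρ i))) (ps (suc i)))
          x≡ (trans (cong suc ρ≡) (next-column ε e m P)) (trans (cong suc yz) (sym (+-suc y z)))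
          (trans n≡ (+-suc ρ (suc r))) (step-fuel {m = m} {m′ = suc m} fuel (positive≤1 (suc m)))))
        (cong (λ j → c * j + bounceN w) (sym (+-suc z (suc r))))

    next-column : ∀ ε e m P → suc (ε + e + m + P) ≡ ε + e + suc m + P
    next-column = solve 4 (λ ε e m P → con 1 :+ (ε :+ e :+ m :+ P) := ε :+ e :+ (con 1 :+ m) :+ P) refl

    loopW : ∀ {r e m} (w : Walk r e m) {F x y z ρ ε P} c →
      Invariant r e m (barPath (toList (peaksW w)) (pathW w)) (toList (peaksW w)) F x y z ρ ε P →
      loop F x y c ≡ c * (z + suc r) + bounceW w
    loopW (north w) c inv = loopN w c inv
    loopW (east {e = e} {m} w) {ρ = ρ} {ε} {P} c (invariant hs ps x≡ ρ≡ yz n≡ fuel)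
      rewrite barPath-E (toList (peaksW w)) (pathW w) =
      loopW w c (invariant (λ i → trans (cong (nth heights) (sym (+-suc ε i))) (hs (suc i))) ps
        (trans x≡ (+-suc ε e)) (trans ρ≡ (cong (λ j → j + m + P) (+-suc ε e))) yz n≡ fuel)
    loopW (turn {r} {m} w) {suc F} {x} {y} {z} {ρ} {ε} {P} c (invariant hs ps x≡ ρ≡ refl n≡ (s≤s fuel))
      rewrite barPath-E (toList (peaksW w)) (pathW w) =
      -- As e = 0, the next east step of the bar path is the one at abscissa x, and it starts at the
      -- current height ρ.
      trans (loop-turn F x y z c r P
              (trans (cong (nth heights) x≡) (hs 0)) n≡
              (trans (cong (λ j → countTrue (take j peaks)) (sym (+-identityʳ ρ))) (trans (ps 0) (+-identityʳ P))))
        (trans (cong (c * z +_) (loopW w (suc c) (invariant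
            (λ i → trans (cong (nth heights) (sym (+-suc ε i))) (hs (suc i))) ps
            -- The modified diagonal is met at ρ - P = ε + m + 1. After the east step just read, m
            -- columns remain before it.
            (trans (cong (_∸ P) ρ≡) (trans (m+n∸n≡m (ε + 0 + suc m) P) (solve 2 (λ ε m → ε :+ con 0 :+ (con 1 :+ m) := con 1 :+ ε :+ m) refl ε m)))
            (trans ρ≡ (solve 3 (λ ε m P → ε :+ con 0 :+ (con 1 :+ m) :+ P := con 1 :+ ε :+ m :+ con 0 :+ P) refl ε m P))
            (sym (+-identityʳ ρ)) n≡
            (ℕ.≤-trans (ℕ.≤-reflexive (trans (+-identityʳ (suc r)) (sym (+-comm r 1)))) fuel))))
          (solve 4 (λ c z r b → c :* z :+ ((con 1 :+ c) :* (con 0 :+ (con 1 :+ r)) :+ b) := c :* (z :+ (con 1 :+ r)) :+ (con 1 :+ r :+ b)) refl c z r (bounceW w)))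

codeBounce : ∀ {r} → Code r → ℕ
codeBounce {r} (p , k , l) =
  bounceLoop (suc (suc r)) (suc r) (eastHeights 0 (barPath (toList k) p)) (toList k) 0 0 0

codeBounce-walk : ∀ {r} (w : NorthWalk r 0 0) → codeBounce (codeN w) ≡ bounceN w
codeBounce-walk {r} w = Loop.loopN (suc r) (eastHeights 0 (barPath k (pathN w))) k w {suc (suc r)} {0} {0} {0} {0} {0} {0} 0
  (Loop.invariant (λ _ → refl) (λ _ → refl) refl refl refl refl (ℕ.≤-trans (ℕ.≤-reflexive (+-identityʳ (suc r))) (ℕ.n≤1+n (suc r))))
  where k = toList (peaksN w)

-- The bijection on walks.

swap : Stat → Stat
swap (stat a b A B) = stat b a A B

mutual
  statN-swap : ∀ {r e m} (w : NorthWalk r e m) s → RP.statN w s ≡ swap (PR.statN w (swap s))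
  statN-swap last      s = refl
  statN-swap (star w)  s = statW-swap w (inc rise♯ s)
  statN-swap (plain w) s = statW-swap w s
  statN-swap (prime w) s = statN-swap w (inc peak♯ s)

  statW-swap : ∀ {r e m} (w : Walk r e m) s → RP.statW w s ≡ swap (PR.statW w (swap s))
  statW-swap (north {e = e} {m} w) s = statN-swap w (addCells (e + m) s)
  statW-swap (east w)              s = statW-swap w s
  statW-swap (turn {r} w)          s = statW-swap w (addLabels (suc r) s)

cong-stat : ∀ {a a′ b b′ A A′ B B′} → a ≡ a′ → b ≡ b′ → A ≡ A′ → B ≡ B′ → stat a b A B ≡ stat a′ b′ A′ B′
cong-stat refl refl refl refl = refl

mutual
  statN-code : ∀ {r e m} (w : NorthWalk r e m) a b A B → PR.statN w (stat a b A B) ≡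
    stat (countTrue (toList (peaksN w)) + a) (countTrue (toList (risesN w)) + b) (areaN w + A) (bounceN w + B)
  statN-code last      a b A B = refl
  statN-code (star w)  a b A B = trans (statW-code w (suc a) b A B) (cong-stat (+-suc _ a) refl refl refl)
  statN-code (plain w) a b A B = statW-code w a b A B
  statN-code (prime w) a b A B = trans (statN-code w a (suc b) A B) (cong-stat refl (+-suc _ b) refl refl)

  statW-code : ∀ {r e m} (w : Walk r e m) a b A B → PR.statW w (stat a b A B) ≡
    stat (countTrue (toList (peaksW w)) + a) (countTrue (toList (risesW w)) + b) (areaW w + A) (bounceW w + B)
  statW-code (north {e = e} {m} w) a b A B =
    trans (statN-code w a b (e + m + A) B) (cong-stat refl refl (exchange (areaN w) (e + m) A) refl)
  statW-code (east w)     a b A B = statW-code w a b A B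
  statW-code (turn {r} w) a b A B =
    trans (statW-code w a b A (suc r + B)) (cong-stat refl refl refl (exchange (bounceW w) (suc r) B))

  exchange : ∀ a b c → a + (b + c) ≡ b + a + c
  exchange a b c = trans (sym (+-assoc a b c)) (cong (_+ c) (+-comm a b))

origin : Stat
origin = stat 0 0 0 0

statN-origin : ∀ {r} (w : NorthWalk r 0 0) → PR.statN w origin ≡
  stat (countTrue (toList (peaksN w))) (countTrue (toList (risesN w))) (areaN w) (bounceN w)
statN-origin w = trans (statN-code w 0 0 0 0) (cong-stat (+-identityʳ _) (+-identityʳ _) (+-identityʳ _) (+-identityʳ _))

module _ {r : ℕ} where

  -- Every walk lies in the fibre over its own statistics; the bijections of the single fibres are
  -- glued to maps on all walks.
  exchangeMarks restoreMarks : NorthWalk r 0 0 → NorthWalk r 0 0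
  exchangeMarks w = proj₁ (Inverse.to (fibre-symmetry r (PR.statN w origin) origin) (w , refl))
  restoreMarks w = proj₁ (Inverse.from (fibre-symmetry r (RP.statN w origin) origin) (w , refl))

  exchangeMarks-stat : ∀ w → RP.statN (exchangeMarks w) origin ≡ PR.statN w origin
  exchangeMarks-stat w = proj₂ (Inverse.to (fibre-symmetry r (PR.statN w origin) origin) (w , refl))

  restoreMarks-stat : ∀ w → PR.statN (restoreMarks w) origin ≡ RP.statN w origin
  restoreMarks-stat w = proj₂ (Inverse.from (fibre-symmetry r (RP.statN w origin) origin) (w , refl))

  restoreMarks-exchangeMarks : ∀ w → restoreMarks (exchangeMarks w) ≡ w
  restoreMarks-exchangeMarks w =
    trans (any-fibre (exchangeMarks-stat w))
      (cong proj₁ (Inverse.strictlyInverseʳ (fibre-symmetry r (PR.statN w origin) origin) (w , refl)))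
    where
    -- `restoreMarks` uses the fibre over the statistics of its own argument, which agree with those
    -- of the original walk only up to a proof; so the fibre is allowed to vary along h.
    any-fibre : ∀ {w u} (h : RP.statN w origin ≡ u) →
      restoreMarks w ≡ proj₁ (Inverse.from (fibre-symmetry r u origin) (w , h))
    any-fibre refl = refl

  exchangeMarks-restoreMarks : ∀ w → exchangeMarks (restoreMarks w) ≡ w
  exchangeMarks-restoreMarks w =
    trans (any-fibre (restoreMarks-stat w))
      (cong proj₁ (Inverse.strictlyInverseˡ (fibre-symmetry r (RP.statN w origin) origin) (w , refl)))
    where
    any-fibre : ∀ {w u} (h : PR.statN w origin ≡ u) →
      exchangeMarks w ≡ proj₁ (Inverse.to (fibre-symmetry r u origin) (w , h))
    any-fibre refl = refl

  exchangeMarks-code : ∀ w → let w′ = exchangeMarks w in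
    (countTrue (toList (risesN w′)) ≡ countTrue (toList (peaksN w)))
    × (countTrue (toList (peaksN w′)) ≡ countTrue (toList (risesN w)))
    × (areaN w′ ≡ areaN w) × (bounceN w′ ≡ bounceN w)
  exchangeMarks-code w = cong Stat.peaks eq , cong Stat.rises eq , cong Stat.cells eq , cong Stat.labels eq
    where
    w′ = exchangeMarks w
    eq = trans (cong swap (sym (statN-origin w′)))
           (trans (sym (statN-swap w′ origin)) (trans (exchangeMarks-stat w) (statN-origin w)))

-- Transfer to decorated Dyck paths.

∧-intro : ∀ {x y} → T x → T y → T (x ∧ y)
∧-intro p q = Equivalence.from T-∧ (p , q)

∧-elim : ∀ {x y} → T (x ∧ y) → T x × T y
∧-elim = Equivalence.to T-∧

module _ {r : ℕ} where

  private n = suc r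

  code : ∀ {a b} → DBar n a b → Code r
  code (D , _) = path D , peak D , rise D

  code-injective : ∀ {a b} (D D′ : DBar n a b) → code D ≡ code D′ → D ≡ D′
  code-injective (ddp p k l v , h) (ddp _ _ _ v′ , h′) refl
    with refl ← T-irrelevant v v′ | refl ← T-irrelevant h h′ = refl

  record Counts (a b : ℕ) (w : NorthWalk r 0 0) : Set where
    constructor counts
    field
      peak-count : countTrue (toList (peaksN w)) ≡ a
      rise-count : countTrue (toList (risesN w)) ≡ b

  build : ∀ {a b} w → Counts a b w → DBar n a b
  build w (counts ka lb) with admissible ab nn ne pk rs pl ← admissibleN w =
    ddp (pathN w) (peaksN w) (risesN w)
      (∧-intro (∧-intro ab (∧-intro (ℕ.≡⇒≡ᵇ _ _ nn) (ℕ.≡⇒≡ᵇ _ _ ne)))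
        (∧-intro pk (∧-intro rs (∧-intro (ℕ.≡⇒≡ᵇ _ _ ka) (ℕ.≡⇒≡ᵇ _ _ lb)))))
    , pl

  encode : ∀ {a b} (D : DBar n a b) → Σ[ w ∈ NorthWalk r 0 0 ] codeN w ≡ code D
  encode (ddp p k l v , h) with vd , v₁ ← ∧-elim {isDyck n p} v with pk , v₂ ← ∧-elim v₁
    with rs , _ ← ∧-elim v₂ with ab , v₃ ← ∧-elim {aboveDiag 0 p} vd with nn , ne ← ∧-elim v₃ =
    from-walk (encodeW 0 0 0 p k l refl (admissible ab (ℕ.≡ᵇ⇒≡ _ _ nn) (ℕ.≡ᵇ⇒≡ _ _ ne) pk rs h))
    where
    from-walk : ∀ {c} → Σ[ w ∈ Walk r 0 0 ] codeW w ≡ c → Σ[ w ∈ NorthWalk r 0 0 ] codeN w ≡ c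
    -- At e = m = 0 neither `east` nor `turn` exists.
    from-walk (north w , eq) = w , eq

  walk : ∀ {a b} → DBar n a b → NorthWalk r 0 0
  walk D = proj₁ (encode D)

  code-walk : ∀ {a b} (D : DBar n a b) → codeN (walk D) ≡ code D
  code-walk D = proj₂ (encode D)

  walk-counts : ∀ {a b} (D : DBar n a b) → Counts a b (walk D)
  walk-counts D@(ddp p k l v , h) = counts
    (trans (cong (λ c → countTrue (toList (proj₁ (proj₂ c)))) (code-walk D)) (ℕ.≡ᵇ⇒≡ _ _ (proj₁ v₃)))
    (trans (cong (λ c → countTrue (toList (proj₂ (proj₂ c)))) (code-walk D)) (ℕ.≡ᵇ⇒≡ _ _ (proj₂ v₃)))
    where
    v₃ = ∧-elim (proj₂ (∧-elim {toList l ⊆ᵇ riseFlags p} (proj₂ (∧-elim {toList k ⊆ᵇ peakFlags p} (proj₂ (∧-elim {isDyck n p} v))))))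

  codeN-inj : ∀ (w w′ : NorthWalk r 0 0) → codeN w ≡ codeN w′ → w ≡ w′
  codeN-inj w w′ eq = codeN-injective w w′ (cong proj₁ eq) (cong (λ c → proj₁ (proj₂ c)) eq) (cong (λ c → proj₂ (proj₂ c)) eq)

  ψ : ∀ {a b} → DBar n a b → DBar n b a
  ψ D = build (exchangeMarks (walk D)) (exchanged (walk D) (walk-counts D))
    where
    exchanged : ∀ {a b} w → Counts a b w → Counts b a (exchangeMarks w)
    exchanged w (counts ka lb) with l , k , _ ← exchangeMarks-code w = counts (trans k lb) (trans l ka)

  ψ-injective : ∀ {a b} {D D′ : DBar n a b} → ψ D ≡ ψ D′ → D ≡ D′
  ψ-injective {D = D} {D′} eq = code-injective D D′
    (trans (sym (code-walk D)) (trans (cong codeN same-walk) (code-walk D′)))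
    where
    same-walk : walk D ≡ walk D′
    same-walk = trans (sym (restoreMarks-exchangeMarks (walk D)))
      (trans (cong restoreMarks (codeN-inj _ _ (cong code eq))) (restoreMarks-exchangeMarks (walk D′)))

  ψ-surjective : ∀ {a b} (D′ : DBar n b a) → Σ[ D ∈ DBar n a b ] (∀ {D″} → D″ ≡ D → ψ D″ ≡ D′)
  ψ-surjective {a} {b} D′ = D , λ { refl → code-injective (ψ D) D′
      (trans (cong codeN (trans (cong exchangeMarks walk-D) exchange-w)) (code-walk D′)) }
    where
    w = restoreMarks (walk D′)
    exchange-w : exchangeMarks w ≡ walk D′
    exchange-w = exchangeMarks-restoreMarks (walk D′)
    w-counts : ∀ {w′} → exchangeMarks w ≡ w′ → Counts b a w′ → Counts a b w
    w-counts refl (counts kb la) with l , k , _ ← exchangeMarks-code w = counts (trans (sym l) la) (trans (sym k) kb)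
    D : DBar n a b
    D = build w (w-counts exchange-w (walk-counts D′))
    walk-D : walk D ≡ w
    walk-D = codeN-inj _ _ (code-walk D)

  area-walk : ∀ {a b} (D : DBar n a b) → area (proj₁ D) ≡ areaN (walk D)
  area-walk D = trans (cong codeArea (sym (code-walk D))) (codeArea-walk (walk D))

  bounce-walk : ∀ {a b} (D : DBar n a b) → bounce′ (proj₁ D) ≡ bounceN (walk D)
  bounce-walk D = trans (cong codeBounce (sym (code-walk D))) (codeBounce-walk (walk D))

theorem2p4 : (n a b : ℕ) → 1 ≤ n →
    Σ[ ψ ∈ DBar n a b ⤖ DBar n b a ]
    (∀ (D : DBar n a b) →
    (area (proj₁ D) ≡ area (proj₁ (Bijection.to ψ D)))
    × (bounce′ (proj₁ D) ≡ bounce′ (proj₁ (Bijection.to ψ D))))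
theorem2p4 (suc r) a b _ = mk⤖ (ψ-injective , ψ-surjective) , preserved
  where
  preserved : ∀ D → (area (proj₁ D) ≡ area (proj₁ (ψ D))) × (bounce′ (proj₁ D) ≡ bounce′ (proj₁ (ψ D)))
  preserved D with _ , _ , A , B ← exchangeMarks-code (walk D) =
    -- The code of `ψ D` is by definition that of `exchangeMarks (walk D)`, so it need not be
    -- encoded again.
    trans (area-walk D) (trans (sym A) (sym (codeArea-walk (exchangeMarks (walk D)))))
    , trans (bounce-walk D) (trans (sym B) (sym (codeBounce-walk (exchangeMarks (walk D)))))
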